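{- Let $A,B\in\mathbb{Q}$ with $AB\neq0$. If $x^4+Ax+B$ has a rational root $r$ and the polynomial $(x^{12}+Ax^3+B)/(x^3-r)$ has a cubic factor in $\mathbb{Q}[x]$, then either $$(A,B)=\bigl(-(r-w)(r^2+w^2),\,-rw(r^2-rw+w^2)\bigr)\quad\text{for some } w\in\mathbb{Q},\ rw(r-w)\neq0,$$ with factorization $$x^{12}+Ax^3+B=(x^3-r)(x^3+w)\bigl(x^6+(r-w)x^3+r^2-rw+w^2\bigr);$$ or, up to scaling, $(A,B)=(128,256)$ or $(A,B)=(-5616,-3888)$, with $$x^{12}+128x^3+256=(x^3+4)(x^3+2x^2+4x+4)(x^6-2x^5+8x^2-16x+16),$$ $$x^{12}-5616x^3-3888=(x^3-18)(x^3+6x+6)(x^6-6x^4+12x^3+36x^2-36x+36).$$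
   Context: Trinomials are considered up to scaling: $x^{12}+Ax^3+B$ and $x^{12}+A\lambda^{9}x^3+B\lambda^{12}$ are identified for $\lambda\in\mathbb{Q}\setminus\{0\}$; "up to scaling $(A,B)=(A_0,B_0)$" means $(A,B)=(A_0\lambda^{9},B_0\lambda^{12})$ for some $\lambda\in\mathbb{Q}\setminus\{0\}$. -}

module Defs where

open import Level using (0ℓ)
open import Data.Unit.Base using (tt) public
open import Data.Nat.Base using (ℕ; zero; suc; _<_)
open import Data.Rational.Base using (ℚ; _+_; _*_; -_; +-*-rawSemiring)
open import Data.List.Base using (List; []; _∷_; map)
open import Data.Product.Base using (Σ-syntax; _×_)
open import Relation.Binary.PropositionalEquality.Core using (_≡_; _≢_)
open import Algebra.Bundles.Raw using (RawRing)
open import Agda.Builtin.FromNat using (Number; fromNat) public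
import Data.Nat.Literals as ℕ
import Data.Rational.Literals as ℚ
import Algebra.Definitions.RawSemiring as RawSemiringDefs

instance
  number-ℕ : Number ℕ
  number-ℕ = ℕ.number

  number-ℚ : Number ℚ
  number-ℚ = ℚ.number

open RawSemiringDefs +-*-rawSemiring public using (_^_)

-- A polynomial in ℚ[x] is a list of coefficients, constant term first.
-- Trailing zeros are allowed, so polynomials are compared with _≈_ and not _≡_.

Poly : Set
Poly = List ℚ

coeff : Poly → ℕ → ℚ
coeff []      _       = 0
coeff (a ∷ p) zero    = a
coeff (a ∷ p) (suc n) = coeff p n

infix 4 _≈_
_≈_ : Poly → Poly → Set
p ≈ q = ∀ n → coeff p n ≡ coeff q n

C : ℚ → Poly
C a = a ∷ []

X : Poly
X = 0 ∷ 1 ∷ []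

infixl 6 _+ₚ_ _-ₚ_
infixl 7 _*ₚ_

_+ₚ_ : Poly → Poly → Poly
[]      +ₚ q       = q
(a ∷ p) +ₚ []      = a ∷ p
(a ∷ p) +ₚ (b ∷ q) = a + b ∷ p +ₚ q

-ₚ_ : Poly → Poly
-ₚ p = map -_ p

_-ₚ_ : Poly → Poly → Poly
p -ₚ q = p +ₚ (-ₚ q)

-- (a + x p) q = a q + x (p q)
_*ₚ_ : Poly → Poly → Poly
[]      *ₚ q = []
(a ∷ p) *ₚ q = map (a *_) q +ₚ (0 ∷ p *ₚ q)

polyRawRing : RawRing 0ℓ 0ℓ
polyRawRing = record
  { Carrier = Poly
  ; _≈_     = _≈_
  ; _+_     = _+ₚ_
  ; _*_     = _*ₚ_
  ; -_      = -ₚ_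
  ; 0#      = []
  ; 1#      = C 1
  }

open RawSemiringDefs (RawRing.rawSemiring polyRawRing) public
  using (_∣_) renaming (_^_ to _^ₚ_)

eval : Poly → ℚ → ℚ
eval []      x = 0
eval (a ∷ p) x = a + x * eval p x

IsRoot : Poly → ℚ → Set
IsRoot p x = eval p x ≡ 0

HasDegree : Poly → ℕ → Set
HasDegree p d = coeff p d ≢ 0 × (∀ n → d < n → coeff p n ≡ 0)

-- Factors need not be monic or irreducible.
HasFactorOfDegree : Poly → ℕ → Set
HasFactorOfDegree p d = Σ[ f ∈ Poly ] HasDegree f d × f ∣ p

trinomial : ℕ → ℕ → ℚ → ℚ → Poly
trinomial n k A B = X ^ₚ n +ₚ C A *ₚ X ^ₚ k +ₚ C B

-- The substitution x ↦ x / t followed by multiplication by t¹² turns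
-- x¹² + A₀ x³ + B₀ into x¹² + A₀ t⁹ x³ + B₀ t¹².
UpToScaling : (A B A₀ B₀ : ℚ) → Set
UpToScaling A B A₀ B₀ =
  Σ[ t ∈ ℚ ] t ≢ 0 × A ≡ A₀ * t ^ 9 × B ≡ B₀ * t ^ 12

{-# OPTIONS --safe #-}
-- Put c = r³ + A and g(y) = y³ + ry² + r²y + c, so that the quotient is g(x³).
-- Let f = x³ + ax² + bx + d divide g(x³) and let χ be the monic cubic whose
-- roots are the cubes of the roots of f. Modulo f, both g and χ vanish at x³,
-- so either g = χ or g has a rational root −w; the latter gives the family.
-- If g = χ, then χ₂² = χ₁ for the coefficients of χ. This is a curve of genus
-- one, which in suitable coordinates reads A + B + C = 9k, ABC = 18k³, and its
-- rational points with k = 0 give the two sporadic trinomials.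
-- That k = 0 is proved by descent along two isogenies of degree 3. In a
-- solution of minimal k ≠ 0 the numbers A, B, C are pairwise coprime, hence
-- a³, b³, 18c³ up to order, and k = abc. Then a³ + b³ + 18c³ = 9abc factors
-- over ℤ[ω] into coprime factors; taking cube roots there produces a solution
-- of the original system with a proper divisor of k in the place of k.
module Submission where

open import Algebra.Bundles using (CommutativeRing)
open import Data.Empty using (⊥; ⊥-elim)
open import Data.List.Base using (List; []; _∷_; map)
open import Data.List.Relation.Unary.All using (All; []; _∷_)
open import Data.Nat.Base as ℕ using (ℕ; zero; suc; z≤n; s≤s)
open import Data.Nat.Divisibility as ℕ using ()
open import Data.Nat.Induction using (<-wellFounded; Acc; acc)
open import Data.Nat.ListAction using (product)
open import Data.Nat.Primality using (Prime; prime[2]; ¬prime[1]; prime?; euclidsLemma; prime⇒irreducible; prime⇒nonTrivial)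
open import Data.Nat.Primality.Factorisation using (factorise; PrimeFactorisation)
open import Data.Nat.Properties as ℕ using ()
open import Data.Product.Base using (Σ-syntax; ∃-syntax; _×_; _,_; proj₁; proj₂)
open import Data.Sum.Base as Sum using (_⊎_; inj₁; inj₂; [_,_]′)
open import Function.Base using (_∘_)
open import Level using (0ℓ; _⊔_)
open import Relation.Nullary.Decidable using (Dec; yes; no; from-yes; from-no; dec⇒maybe)
open import Relation.Nullary.Negation using (¬_; contradiction)

-- The obstacle is that the curve does have rational points. There are three, all with k = 0; in the
-- notation used for `curve` they are a = 0, H = G = 0 and H = F = 0, and the last belongs to f = (x
-- + a)(x² + a²) with A = 0. Descent therefore has to act on k itself. This explains the model: each
-- of A, B, C vanishes to third order at one of these points, so unique factorisation makes them
-- cubes up to divisors of 18. Two obstructions are removed modulo 9. One is the other way to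
-- distribute the factor 18, namely 9a³ + b³ + 2c³ = 9abc. The other comes from the units ω and ω²,
-- which are not cubes in ℤ[ω]. The factorisation over ℤ[ω] is that of x³ + y³ + z³ - 3xyz at z =
-- 3c, which appears after 9c³ is added to both sides. On the polynomial side division is replaced
-- by duality: a polynomial is a functional on sequences, and divisibility by f means that it kills
-- every sequence satisfying the recurrence of f.

-- Bézout identities and products that are cubes, in a Euclidean ring.

module Euclidean {c ℓ} (R : CommutativeRing c ℓ) where
  open CommutativeRing R
  open import Algebra.Solver.Ring.NaturalCoefficients.Default commutativeSemiring
  open import Relation.Binary.Reasoning.Setoid setoid

  *-cubes : ∀ x y z → x * (y * y * y) * (z * z * z) ≈ x * (y * z * (y * z) * (y * z))
  *-cubes = solve 3 (λ x y z →
    x :* (y :* y :* y) :* (z :* z :* z) := x :* (y :* z :* (y :* z) :* (y :* z))) refl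

  Comaximal : Carrier → Carrier → Set _
  Comaximal a b = ∃[ x ] ∃[ y ] x * a + y * b ≈ 1#

  record Bézout (a b : Carrier) : Set (c ⊔ ℓ) where
    field
      gcd x y a/gcd b/gcd : Carrier
      identity : gcd ≈ x * a + y * b
      gcd∣a    : a ≈ gcd * a/gcd
      gcd∣b    : b ≈ gcd * b/gcd

  module _ (ν : Carrier → ℕ)
           (divide : ∀ a b → b ≈ 0# ⊎ (∃[ q ] ∃[ r ] a ≈ q * b + r × ν r ℕ.< ν b)) where

    bézout : ∀ a b → Bézout a b
    bézout a b = go a b (<-wellFounded (ν b))
      where
      go : ∀ a b → Acc ℕ._<_ (ν b) → Bézout a b
      go a b (acc rec) with divide a b
      ... | inj₁ b≈0 = record
        { gcd = a ; x = 1# ; y = 0# ; a/gcd = 1# ; b/gcd = 0#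
        ; identity = sym (trans (+-cong (*-identityˡ a) (zeroˡ b)) (+-identityʳ a))
        ; gcd∣a = sym (*-identityʳ a)
        ; gcd∣b = trans b≈0 (sym (zeroʳ a))
        }
      ... | inj₂ (q , r , a≈qb+r , r<b) = record
        { gcd = gcd ; x = y ; y = x + y * - q ; a/gcd = q * a/gcd + b/gcd ; b/gcd = a/gcd
        ; identity = begin
            gcd                                 ≈⟨ identity ⟩
            x * b + y * r                       ≈⟨ +-identityʳ _ ⟨
            x * b + y * r + 0#                  ≈⟨ +-congˡ (zeroˡ (y * b)) ⟨
            x * b + y * r + 0# * (y * b)        ≈⟨ +-congˡ (*-congʳ (-‿inverseʳ q)) ⟨
            x * b + y * r + (q + - q) * (y * b) ≈⟨ solve 6 (λ b r x y q q⁻ →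
                x :* b :+ y :* r :+ (q :+ q⁻) :* (y :* b) :=
                y :* (q :* b :+ r) :+ (x :+ y :* q⁻) :* b) refl b r x y q (- q) ⟩
            y * (q * b + r) + (x + y * - q) * b ≈⟨ +-congʳ (*-congˡ a≈qb+r) ⟨
            y * a + (x + y * - q) * b           ∎
        ; gcd∣a = begin
            a                                   ≈⟨ a≈qb+r ⟩
            q * b + r                           ≈⟨ +-cong (*-congˡ gcd∣a) gcd∣b ⟩
            q * (gcd * a/gcd) + gcd * b/gcd     ≈⟨ solve 4 (λ q g a b →
                q :* (g :* a) :+ g :* b := g :* (q :* a :+ b)) refl q gcd a/gcd b/gcd ⟩
            gcd * (q * a/gcd + b/gcd)           ∎
        ; gcd∣b = gcd∣a
        }
        where open Bézout (go b r (rec r<b))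

  module _ (cancel : ∀ g {a b} → ¬ g ≈ 0# → g * a ≈ g * b → a ≈ b)
           (bézout : ∀ a b → Bézout a b) where

    -- No prime factorisation is involved. With g the gcd of a and c, and a = ga', c = gc', one gets
    -- a'b = g²c'³. Since g is comaximal with b, g² divides a'. The quotient ε divides both a' and
    -- c'³, which are comaximal, and is therefore a unit.
    comaximal-cube : ∀ {a b c} → ¬ c ≈ 0# → Comaximal a b → a * b ≈ c * c * c →
      ∃[ ε ] ∃[ ε⁻¹ ] ∃[ g ] ∃[ h ]
        ε * ε⁻¹ ≈ 1# × a ≈ ε * (g * g * g) × ε * b ≈ h * h * h × c ≈ g * h
    comaximal-cube {a} {b} {c} c≉0 (x , y , xa+yb≈1) ab≈c³ =
      ε , g * g * w + t * t * t * b , g , c' , unit , a≈εg³ , εb≈c'³ , gcd∣b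
      where
      open Bézout (bézout a c) renaming
        (gcd to g; x to s; y to t; a/gcd to a'; b/gcd to c')

      g≉0 : ¬ g ≈ 0#
      g≉0 g≈0 = c≉0 (trans gcd∣b (trans (*-congʳ g≈0) (zeroˡ c')))

      sa'+tc'≈1 : s * a' + t * c' ≈ 1#
      sa'+tc'≈1 = cancel g g≉0 (begin
        g * (s * a' + t * c')       ≈⟨ solve 5 (λ g s a' t c' →
            g :* (s :* a' :+ t :* c') := s :* (g :* a') :+ t :* (g :* c')) refl g s a' t c' ⟩
        s * (g * a') + t * (g * c') ≈⟨ +-cong (*-congˡ gcd∣a) (*-congˡ gcd∣b) ⟨
        s * a + t * c               ≈⟨ identity ⟨
        g                           ≈⟨ *-identityʳ g ⟨
        g * 1#                      ∎)

      a'b≈g²c'³ : a' * b ≈ g * g * (c' * c' * c')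
      a'b≈g²c'³ = cancel g g≉0 (begin
        g * (a' * b)                     ≈⟨ *-assoc g a' b ⟨
        g * a' * b                       ≈⟨ *-congʳ gcd∣a ⟨
        a * b                            ≈⟨ ab≈c³ ⟩
        c * c * c                        ≈⟨ *-cong (*-cong gcd∣b gcd∣b) gcd∣b ⟩
        g * c' * (g * c') * (g * c')     ≈⟨ solve 2 (λ g c' →
            g :* c' :* (g :* c') :* (g :* c') := g :* (g :* g :* (c' :* c' :* c'))) refl g c' ⟩
        g * (g * g * (c' * c' * c'))     ∎)

      -- `e` is the coefficient of g in the identity eg + yb = 1. Multiplying a' by the square of
      -- this identity leaves a multiple of g² and `z` times a'b, which is itself a multiple of g².
      e = x * a'
      z = e * g * y + e * g * y + y * y * b
      ε = a' * (e * e) + c' * c' * c' * z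

      eg+yb≈1 : e * g + y * b ≈ 1#
      eg+yb≈1 = begin
        x * a' * g + y * b   ≈⟨ +-congʳ
          (solve 3 (λ x a' g → x :* a' :* g := x :* (g :* a')) refl x a' g) ⟩
        x * (g * a') + y * b ≈⟨ +-congʳ (*-congˡ gcd∣a) ⟨
        x * a + y * b        ≈⟨ xa+yb≈1 ⟩
        1#                   ∎

      a'≈g²ε : a' ≈ g * g * ε
      a'≈g²ε = begin
        a'                                            ≈⟨ *-identityʳ a' ⟨
        a' * 1#                                       ≈⟨ *-congˡ (*-identityʳ 1#) ⟨
        a' * (1# * 1#)                                ≈⟨ *-congˡ (*-cong eg+yb≈1 eg+yb≈1) ⟨
        a' * ((e * g + y * b) * (e * g + y * b))      ≈⟨ solve 5 (λ a' e g y b →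
            a' :* ((e :* g :+ y :* b) :* (e :* g :+ y :* b)) :=
            a' :* (g :* g :* (e :* e)) :+ a' :* b :* (e :* g :* y :+ e :* g :* y :+ y :* y :* b))
            refl a' e g y b ⟩
        a' * (g * g * (e * e)) + a' * b * z           ≈⟨ +-congˡ (*-congʳ a'b≈g²c'³) ⟩
        a' * (g * g * (e * e)) + g * g * (c' * c' * c') * z ≈⟨ solve 5 (λ a' g e c' z →
            a' :* (g :* g :* (e :* e)) :+ g :* g :* (c' :* c' :* c') :* z :=
            g :* g :* (a' :* (e :* e) :+ c' :* c' :* c' :* z)) refl a' g e c' z ⟩
        g * g * ε                                     ∎

      a≈εg³ : a ≈ ε * (g * g * g)
      a≈εg³ = begin
        a               ≈⟨ gcd∣a ⟩
        g * a'          ≈⟨ *-congˡ a'≈g²ε ⟩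
        g * (g * g * ε) ≈⟨ solve 2 (λ g ε → g :* (g :* g :* ε) := ε :* (g :* g :* g)) refl g ε ⟩
        ε * (g * g * g) ∎

      εb≈c'³ : ε * b ≈ c' * c' * c'
      εb≈c'³ = cancel g g≉0 (cancel g g≉0 (begin
        g * (g * (ε * b))
          ≈⟨ solve 3 (λ g ε b → g :* (g :* (ε :* b)) := g :* g :* ε :* b) refl g ε b ⟩
        g * g * ε * b                ≈⟨ *-congʳ a'≈g²ε ⟨
        a' * b                       ≈⟨ a'b≈g²c'³ ⟩
        g * g * (c' * c' * c')       ≈⟨ *-assoc g g _ ⟩
        g * (g * (c' * c' * c'))     ∎))

      -- The cofactor of a' in the binomial expansion (sa' + tc')³ = a'w + t³c'³.
      w = s * s * s * a' * a' + (s * s * a' * t * c' + s * s * a' * t * c' + s * s * a' * t * c')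
        + (s * t * t * c' * c' + s * t * t * c' * c' + s * t * t * c' * c')

      unit : ε * (g * g * w + t * t * t * b) ≈ 1#
      unit = begin
        ε * (g * g * w + t * t * t * b)   ≈⟨ solve 5 (λ ε g w t b →
            ε :* (g :* g :* w :+ t :* t :* t :* b) :=
            g :* g :* ε :* w :+ t :* t :* t :* (ε :* b)) refl ε g w t b ⟩
        g * g * ε * w + t * t * t * (ε * b) ≈⟨ +-cong (*-congʳ (sym a'≈g²ε)) (*-congˡ εb≈c'³) ⟩
        a' * w + t * t * t * (c' * c' * c') ≈⟨ solve 4 (λ s a' t c' →
            a' :* (s :* s :* s :* a' :* a'
              :+ (s :* s :* a' :* t :* c' :+ s :* s :* a' :* t :* c' :+ s :* s :* a' :* t :* c')
              :+ (s :* t :* t :* c' :* c' :+ s :* t :* t :* c' :* c' :+ s :* t :* t :* c' :* c'))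
              :+ t :* t :* t :* (c' :* c' :* c') :=
            (s :* a' :+ t :* c') :* (s :* a' :+ t :* c') :* (s :* a' :+ t :* c')) refl s a' t c' ⟩
        (s * a' + t * c') * (s * a' + t * c') * (s * a' + t * c')
          ≈⟨ *-cong (*-cong sa'+tc'≈1 sa'+tc'≈1) sa'+tc'≈1 ⟩
        1# * 1# * 1#                      ≈⟨ trans (*-identityʳ _) (*-identityʳ _) ⟩
        1#                                ∎

open import Relation.Binary.PropositionalEquality

-- Integer identities and Euclidean division in ℤ.

module Integers where
  open import Data.Integer.Base as ℤ using (ℤ; +_; -[1+_]; ∣_∣; _+_; _*_; _-_; -_; 0ℤ; 1ℤ)
  open import Data.Integer.Properties as ℤ using (_≟_)
  open import Data.Integer.DivMod using (a≡a%n+[a/n]*n; n%d<d)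
  open import Data.Integer.Divisibility.Signed
  open import Data.Integer.Tactic.RingSolver using (solve-∀)
  open import Data.Nat.Tactic.RingSolver using () renaming (solve-∀ to ℕ-solve-∀)

  -- An equation is derived by exhibiting the difference of its sides as a
  -- combination of differences that vanish by hypothesis.
  from-eq : ∀ {x y l r} m → l ≡ r → x - y ≡ m * (l - r) → x ≡ y
  from-eq {x} {y} {l} m refl eq =
    ℤ.i-j≡0⇒i≡j x y (trans eq (trans (cong (m *_) (ℤ.+-inverseʳ l)) (ℤ.*-zeroʳ m)))

  from-eqs : ∀ {x y l r l' r'} m m' → l ≡ r → l' ≡ r' →
             x - y ≡ m * (l - r) + m' * (l' - r') → x ≡ y
  from-eqs {x} {y} {l} {r} {l'} m m' h refl eq = from-eq m h
    (trans eq (trans (cong (λ z → m * (l - r) + m' * z) (ℤ.+-inverseʳ l'))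
      (trans (cong (λ z → m * (l - r) + z) (ℤ.*-zeroʳ m')) (ℤ.+-identityʳ _))))

  square-abs : ∀ i → i * i ≡ + (∣ i ∣ ℕ.* ∣ i ∣)
  square-abs (+ n)    = sym (ℤ.pos-* n n)
  square-abs -[1+ n ] = refl

  sum-of-squares : ∀ i j k → i * i + j * j + k * k
    ≡ + (∣ i ∣ ℕ.* ∣ i ∣ ℕ.+ ∣ j ∣ ℕ.* ∣ j ∣ ℕ.+ ∣ k ∣ ℕ.* ∣ k ∣)
  sum-of-squares i j k rewrite square-abs i | square-abs j | square-abs k = refl

  ℤ-divide : ∀ a b → b ≡ 0ℤ ⊎ (∃[ q ] ∃[ r ] a ≡ q * b + r × ∣ r ∣ ℕ.< ∣ b ∣)
  ℤ-divide a b with b ≟ 0ℤ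
  ... | yes b≡0 = inj₁ b≡0
  ... | no  b≢0 = inj₂ (a ℤ./ b , + (a ℤ.% b)
    , trans (a≡a%n+[a/n]*n a b) (ℤ.+-comm (+ (a ℤ.% b)) (a ℤ./ b * b)) , n%d<d a b)
    where instance _ = ℤ.≢-nonZero b≢0

  ℤ-cancel : ∀ g {a b} → ¬ g ≡ 0ℤ → g * a ≡ g * b → a ≡ b
  ℤ-cancel g {a} {b} g≢0 = ℤ.*-cancelˡ-≡ g a b {{ℤ.≢-nonZero g≢0}}

  module ℤ-Euclidean = Euclidean ℤ.+-*-commutativeRing

  ℤ-bézout : ∀ a b → ℤ-Euclidean.Bézout a b
  ℤ-bézout = ℤ-Euclidean.bézout ∣_∣ ℤ-divide

  -- The Eisenstein integers as a Euclidean ring.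

  -- ⟨ x , y ⟩ is x + y ω with ω² + ω + 1 = 0.
  record Eisenstein : Set where
    constructor ⟨_,_⟩
    field re im : ℤ

  infixl 6 _⊕_
  infixl 7 _⊗_

  _⊕_ _⊗_ : Eisenstein → Eisenstein → Eisenstein
  ⟨ x , y ⟩ ⊕ ⟨ u , v ⟩ = ⟨ x + u , y + v ⟩
  ⟨ x , y ⟩ ⊗ ⟨ u , v ⟩ = ⟨ x * u - y * v , x * v + y * u - y * v ⟩

  ⊖_ conj : Eisenstein → Eisenstein
  ⊖ ⟨ x , y ⟩ = ⟨ - x , - y ⟩
  conj ⟨ x , y ⟩ = ⟨ x - y , - y ⟩

  norm : Eisenstein → ℤ
  norm ⟨ x , y ⟩ = x * x - x * y + y * y

  𝟘 𝟙 ω : Eisenstein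
  𝟘 = ⟨ + 0 , + 0 ⟩
  𝟙 = ⟨ + 1 , + 0 ⟩
  ω = ⟨ + 0 , + 1 ⟩

  Eisenstein-commutativeRing : CommutativeRing _ _
  Eisenstein-commutativeRing = record
    { Carrier = Eisenstein ; _≈_ = _≡_ ; _+_ = _⊕_ ; _*_ = _⊗_ ; -_ = ⊖_ ; 0# = 𝟘 ; 1# = 𝟙
    ; isCommutativeRing = record
      { isRing = record
        { +-isAbelianGroup = record
          { isGroup = record
            { isMonoid = record
              { isSemigroup = record
                { isMagma = record { isEquivalence = isEquivalence ; ∙-cong = cong₂ _⊕_ }
                ; assoc = λ { ⟨ a , b ⟩ ⟨ c , d ⟩ ⟨ e , f ⟩ →
                  cong₂ ⟨_,_⟩ (ℤ.+-assoc a c e) (ℤ.+-assoc b d f) } }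
              ; identity = (λ { ⟨ a , b ⟩ → cong₂ ⟨_,_⟩ (ℤ.+-identityˡ a) (ℤ.+-identityˡ b) })
                         , (λ { ⟨ a , b ⟩ → cong₂ ⟨_,_⟩ (ℤ.+-identityʳ a) (ℤ.+-identityʳ b) }) }
            ; inverse = (λ { ⟨ a , b ⟩ → cong₂ ⟨_,_⟩ (ℤ.+-inverseˡ a) (ℤ.+-inverseˡ b) })
                      , (λ { ⟨ a , b ⟩ → cong₂ ⟨_,_⟩ (ℤ.+-inverseʳ a) (ℤ.+-inverseʳ b) })
            ; ⁻¹-cong = cong ⊖_ }
          ; comm = λ { ⟨ a , b ⟩ ⟨ c , d ⟩ → cong₂ ⟨_,_⟩ (ℤ.+-comm a c) (ℤ.+-comm b d) } }
        ; *-cong = cong₂ _⊗_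
        ; *-assoc = λ { ⟨ a , b ⟩ ⟨ c , d ⟩ ⟨ e , f ⟩ →
            cong₂ ⟨_,_⟩ (assoc-re a b c d e f) (assoc-im a b c d e f) }
        ; *-identity = (λ { ⟨ a , b ⟩ → cong₂ ⟨_,_⟩ (identityˡ-re a b) (identityˡ-im a b) })
                     , (λ { ⟨ a , b ⟩ → cong₂ ⟨_,_⟩ (identityʳ-re a b) (identityʳ-im a b) })
        ; distrib = (λ { ⟨ a , b ⟩ ⟨ c , d ⟩ ⟨ e , f ⟩ →
                        cong₂ ⟨_,_⟩ (distribˡ-re a b c d e f) (distribˡ-im a b c d e f) })
                  , (λ { ⟨ a , b ⟩ ⟨ c , d ⟩ ⟨ e , f ⟩ →
                        cong₂ ⟨_,_⟩ (distribʳ-re a b c d e f) (distribʳ-im a b c d e f) }) }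
      ; *-comm = λ { ⟨ a , b ⟩ ⟨ c , d ⟩ → cong₂ ⟨_,_⟩ (comm-re a b c d) (comm-im a b c d) } } }
    where
    assoc-re : ∀ a b c d e f → (a * c - b * d) * e - (a * d + b * c - b * d) * f
      ≡ a * (c * e - d * f) - b * (c * f + d * e - d * f)
    assoc-re = solve-∀
    assoc-im : ∀ a b c d e f →
      (a * c - b * d) * f + (a * d + b * c - b * d) * e - (a * d + b * c - b * d) * f
      ≡ a * (c * f + d * e - d * f) + b * (c * e - d * f) - b * (c * f + d * e - d * f)
    assoc-im = solve-∀
    identityˡ-re : ∀ a b → + 1 * a - + 0 * b ≡ a
    identityˡ-re = solve-∀
    identityˡ-im : ∀ a b → + 1 * b + + 0 * a - + 0 * b ≡ b
    identityˡ-im = solve-∀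
    identityʳ-re : ∀ a b → a * + 1 - b * + 0 ≡ a
    identityʳ-re = solve-∀
    identityʳ-im : ∀ a b → a * + 0 + b * + 1 - b * + 0 ≡ b
    identityʳ-im = solve-∀
    distribˡ-re : ∀ a b c d e f → a * (c + e) - b * (d + f) ≡ a * c - b * d + (a * e - b * f)
    distribˡ-re = solve-∀
    distribˡ-im : ∀ a b c d e f → a * (d + f) + b * (c + e) - b * (d + f)
      ≡ a * d + b * c - b * d + (a * f + b * e - b * f)
    distribˡ-im = solve-∀
    distribʳ-re : ∀ a b c d e f → (c + e) * a - (d + f) * b ≡ c * a - d * b + (e * a - f * b)
    distribʳ-re = solve-∀
    distribʳ-im : ∀ a b c d e f → (c + e) * b + (d + f) * a - (d + f) * b
      ≡ c * b + d * a - d * b + (e * b + f * a - f * b)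
    distribʳ-im = solve-∀
    comm-re : ∀ a b c d → a * c - b * d ≡ c * a - d * b
    comm-re = solve-∀
    comm-im : ∀ a b c d → a * d + b * c - b * d ≡ c * b + d * a - d * b
    comm-im = solve-∀

  norm-⊗ : ∀ z w → norm (z ⊗ w) ≡ norm z * norm w
  norm-⊗ ⟨ a , b ⟩ ⟨ c , d ⟩ = lemma a b c d
    where
    lemma : ∀ a b c d →
      (a * c - b * d) * (a * c - b * d) - (a * c - b * d) * (a * d + b * c - b * d)
        + (a * d + b * c - b * d) * (a * d + b * c - b * d)
      ≡ (a * a - a * b + b * b) * (c * c - c * d + d * d)
    lemma = solve-∀

  -- Doubling turns the form into a sum of three integer squares. This yields both its definiteness
  -- and the enumeration of the units.
  double-norm : ∀ x y → + 2 * norm ⟨ x , y ⟩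
    ≡ + (∣ x ∣ ℕ.* ∣ x ∣ ℕ.+ ∣ y ∣ ℕ.* ∣ y ∣ ℕ.+ ∣ x - y ∣ ℕ.* ∣ x - y ∣)
  double-norm x y = trans (lemma x y) (sum-of-squares x y (x - y))
    where
    lemma : ∀ x y → + 2 * (x * x - x * y + y * y) ≡ x * x + y * y + (x - y) * (x - y)
    lemma = solve-∀

  norm≡0⇒≡𝟘 : ∀ z → norm z ≡ 0ℤ → z ≡ 𝟘
  norm≡0⇒≡𝟘 ⟨ x , y ⟩ N≡0 = cong₂ ⟨_,_⟩ (zero-of x x²≡0) (zero-of y y²≡0)
    where
    x² = ∣ x ∣ ℕ.* ∣ x ∣
    y² = ∣ y ∣ ℕ.* ∣ y ∣
    sum≡0 : x² ℕ.+ y² ℕ.+ ∣ x - y ∣ ℕ.* ∣ x - y ∣ ≡ 0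
    sum≡0 = ℤ.+-injective (trans (sym (double-norm x y)) (cong (+ 2 *_) N≡0))
    x²+y²≡0 : x² ℕ.+ y² ≡ 0
    x²+y²≡0 = ℕ.m+n≡0⇒m≡0 _ sum≡0
    x²≡0 : x² ≡ 0
    x²≡0 = ℕ.m+n≡0⇒m≡0 _ x²+y²≡0
    y²≡0 : y² ≡ 0
    y²≡0 = ℕ.m+n≡0⇒n≡0 x² x²+y²≡0
    zero-of : ∀ i → ∣ i ∣ ℕ.* ∣ i ∣ ≡ 0 → i ≡ 0ℤ
    zero-of i eq with ℕ.m*n≡0⇒m≡0∨n≡0 ∣ i ∣ eq
    ... | inj₁ e = ℤ.∣i∣≡0⇒i≡0 e
    ... | inj₂ e = ℤ.∣i∣≡0⇒i≡0 e

  -- Since x² − xy + y² ≤ max(x, y)² for x, y ≥ 0, division with nonnegative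
  -- coordinatewise remainders, without rounding, makes ℤ[ω] Euclidean.
  norm-bound : ∀ {m n d} → m ℕ.< d → n ℕ.< d → ∣ norm ⟨ + m , + n ⟩ ∣ ℕ.< d ℕ.* d
  norm-bound {m} {n} {d} m<d n<d = [ (λ m≤n → ordered m≤n n<d)
      , (λ n≤m → subst (λ z → ∣ z ∣ ℕ.< d ℕ.* d) (swap (+ n) (+ m)) (ordered n≤m m<d)) ]′
    (ℕ.≤-total m n)
    where
    swap : ∀ x y → x * x - x * y + y * y ≡ y * y - y * x + x * x
    swap = solve-∀
    expand : ∀ x y → x * x - x * (x + y) + (x + y) * (x + y) ≡ x * x + x * y + y * y
    expand = solve-∀
    square : ∀ m k → m ℕ.* m ℕ.+ m ℕ.* k ℕ.+ k ℕ.* k ℕ.+ m ℕ.* k ≡ (m ℕ.+ k) ℕ.* (m ℕ.+ k)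
    square = ℕ-solve-∀
    ordered : ∀ {m n} → m ℕ.≤ n → n ℕ.< d → ∣ norm ⟨ + m , + n ⟩ ∣ ℕ.< d ℕ.* d
    ordered {m} m≤n n<d with ℕ.m≤n⇒∃[o]m+o≡n m≤n
    ... | k , refl = begin-strict
      ∣ norm ⟨ + m , + (m ℕ.+ k) ⟩ ∣                ≡⟨ cong ∣_∣ (trans (expand (+ m) (+ k))
        (cong₂ _+_ (cong₂ _+_ (sym (ℤ.pos-* m m)) (sym (ℤ.pos-* m k))) (sym (ℤ.pos-* k k)))) ⟩
      m ℕ.* m ℕ.+ m ℕ.* k ℕ.+ k ℕ.* k               ≤⟨ ℕ.m≤m+n _ (m ℕ.* k) ⟩
      m ℕ.* m ℕ.+ m ℕ.* k ℕ.+ k ℕ.* k ℕ.+ m ℕ.* k   ≡⟨ square m k ⟩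
      (m ℕ.+ k) ℕ.* (m ℕ.+ k)                       <⟨ ℕ.*-mono-< n<d n<d ⟩
      d ℕ.* d                                       ∎
      where open ℕ.≤-Reasoning

  norm-conj : ∀ z → norm (conj z) ≡ norm z
  norm-conj ⟨ x , y ⟩ = lemma x y
    where
    lemma : ∀ x y → (x - y) * (x - y) - (x - y) * - y + - y * - y ≡ x * x - x * y + y * y
    lemma = solve-∀

  -- Multiplication by `conj w` makes the divisor the integer `norm w`, so a quotient can be chosen
  -- by integer division in each coordinate, without fractions.
  remainder-conj : ∀ z p q w → (z ⊕ ⊖ (⟨ p , q ⟩ ⊗ w)) ⊗ conj w
    ≡ z ⊗ conj w ⊕ ⊖ ⟨ p * norm w , q * norm w ⟩
  remainder-conj ⟨ a , b ⟩ p q ⟨ c , d ⟩ = cong₂ ⟨_,_⟩ (lemma-re a b p q c d) (lemma-im a b p q c d)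
    where
    lemma-re : ∀ a b p q c d →
      (a + - (p * c - q * d)) * (c - d) - (b + - (p * d + q * c - q * d)) * - d
      ≡ a * (c - d) - b * - d + - (p * (c * c - c * d + d * d))
    lemma-re = solve-∀
    lemma-im : ∀ a b p q c d →
      (a + - (p * c - q * d)) * - d + (b + - (p * d + q * c - q * d)) * (c - d)
        - (b + - (p * d + q * c - q * d)) * - d
      ≡ a * - d + b * (c - d) - b * - d + - (q * (c * c - c * d + d * d))
    lemma-im = solve-∀

  ℤ-residue : ∀ i N .{{_ : ℤ.NonZero N}} → ∃[ q ] ∃[ r ] i ≡ + r + q * N × r ℕ.< ∣ N ∣
  ℤ-residue i N = i ℤ./ N , i ℤ.% N , a≡a%n+[a/n]*n i N , n%d<d i N

  𝔼-divide : ∀ a b → b ≡ 𝟘 ⊎ (∃[ q ] ∃[ r ] a ≡ q ⊗ b ⊕ r × ∣ norm r ∣ ℕ.< ∣ norm b ∣)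
  𝔼-divide a b with norm b ≟ 0ℤ
  ... | yes N≡0 = inj₁ (norm≡0⇒≡𝟘 b N≡0)
  ... | no  N≢0 with a ⊗ conj b in a·conj
  ... | ⟨ x , y ⟩ with ℤ-residue x (norm b) {{ℤ.≢-nonZero N≢0}} | ℤ-residue y (norm b)
    {{ℤ.≢-nonZero N≢0}}
  ... | p , r , x≡ , r<N | q , s , y≡ , s<N =
    inj₂ (⟨ p , q ⟩ , ρ , split a (⟨ p , q ⟩ ⊗ b) , ℕ.*-cancelʳ-< _ _ _ (begin-strict
      ∣ norm ρ ∣ ℕ.* ∣ norm b ∣          ≡⟨ cong (λ z → ∣ norm ρ ∣ ℕ.* ∣ z ∣) (norm-conj b) ⟨
      ∣ norm ρ ∣ ℕ.* ∣ norm (conj b) ∣   ≡⟨ ℤ.abs-* (norm ρ) (norm (conj b)) ⟨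
      ∣ norm ρ * norm (conj b) ∣         ≡⟨ cong ∣_∣ (norm-⊗ ρ (conj b)) ⟨
      ∣ norm (ρ ⊗ conj b) ∣              ≡⟨ cong (λ z → ∣ norm z ∣) ρ·conj ⟩
      ∣ norm ⟨ + r , + s ⟩ ∣              <⟨ norm-bound r<N s<N ⟩
      ∣ norm b ∣ ℕ.* ∣ norm b ∣          ∎))
    where
    open ℕ.≤-Reasoning
    ρ = a ⊕ ⊖ (⟨ p , q ⟩ ⊗ b)
    split : ∀ z w → z ≡ w ⊕ (z ⊕ ⊖ w)
    split ⟨ x , y ⟩ ⟨ u , v ⟩ = cong₂ ⟨_,_⟩ (lemma x u) (lemma y v)
      where
      lemma : ∀ x u → x ≡ u + (x + - u)
      lemma = solve-∀
    residue : ∀ {i r s} → i ≡ r + s → i + - s ≡ r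
    residue {i} {r} {s} i≡ = from-eq 1ℤ i≡ (lemma i r s)
      where
      lemma : ∀ i r s → i + - s - r ≡ 1ℤ * (i - (r + s))
      lemma = solve-∀
    ρ·conj : ρ ⊗ conj b ≡ ⟨ + r , + s ⟩
    ρ·conj = trans (remainder-conj a p q b) (trans (cong (_⊕ ⊖ ⟨ p * norm b , q * norm b ⟩) a·conj)
      (cong₂ ⟨_,_⟩ (residue x≡) (residue y≡)))

  module 𝔼-Euclidean = Euclidean Eisenstein-commutativeRing

  𝔼-bézout : ∀ a b → 𝔼-Euclidean.Bézout a b
  𝔼-bézout = 𝔼-Euclidean.bézout (λ z → ∣ norm z ∣) 𝔼-divide

  ⊗≡𝟘 : ∀ z w → z ⊗ w ≡ 𝟘 → z ≡ 𝟘 ⊎ w ≡ 𝟘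
  ⊗≡𝟘 z w zw≡0 = Sum.map (norm≡0⇒≡𝟘 z) (norm≡0⇒≡𝟘 w)
    (ℤ.i*j≡0⇒i≡0∨j≡0 (norm z) (trans (sym (norm-⊗ z w)) (cong norm zw≡0)))

  ⊗-distribˡ-⊖ : ∀ g a b → g ⊗ (a ⊕ ⊖ b) ≡ g ⊗ a ⊕ ⊖ (g ⊗ b)
  ⊗-distribˡ-⊖ ⟨ x , y ⟩ ⟨ a , b ⟩ ⟨ c , d ⟩ = cong₂ ⟨_,_⟩ (lemma-re x y a b c d) (lemma-im x y a b c d)
    where
    lemma-re : ∀ x y a b c d → x * (a + - c) - y * (b + - d) ≡ x * a - y * b + - (x * c - y * d)
    lemma-re = solve-∀
    lemma-im : ∀ x y a b c d → x * (b + - d) + y * (a + - c) - y * (b + - d)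
      ≡ x * b + y * a - y * b + - (x * d + y * c - y * d)
    lemma-im = solve-∀

  ⊕-inverseʳ : ∀ z → z ⊕ ⊖ z ≡ 𝟘
  ⊕-inverseʳ ⟨ x , y ⟩ = cong₂ ⟨_,_⟩ (ℤ.+-inverseʳ x) (ℤ.+-inverseʳ y)

  ⊕⊖≡𝟘 : ∀ a b → a ⊕ ⊖ b ≡ 𝟘 → a ≡ b
  ⊕⊖≡𝟘 ⟨ x , y ⟩ ⟨ u , v ⟩ eq = cong₂ ⟨_,_⟩ (ℤ.i-j≡0⇒i≡j x u (cong Eisenstein.re eq))
                                            (ℤ.i-j≡0⇒i≡j y v (cong Eisenstein.im eq))

  𝔼-cancel : ∀ g {a b} → ¬ g ≡ 𝟘 → g ⊗ a ≡ g ⊗ b → a ≡ b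
  𝔼-cancel g {a} {b} g≢0 ga≡gb =
    [ (λ g≡0 → contradiction g≡0 g≢0) , ⊕⊖≡𝟘 a b ]′ (⊗≡𝟘 g (a ⊕ ⊖ b) (begin
      g ⊗ (a ⊕ ⊖ b)         ≡⟨ ⊗-distribˡ-⊖ g a b ⟩
      g ⊗ a ⊕ ⊖ (g ⊗ b)     ≡⟨ cong (_⊕ ⊖ (g ⊗ b)) ga≡gb ⟩
      g ⊗ b ⊕ ⊖ (g ⊗ b)     ≡⟨ ⊕-inverseʳ (g ⊗ b) ⟩
      𝟘                     ∎))
    where open ≡-Reasoning

  -- Units modulo cubes and cube roots in ℤ and ℤ[ω].

  data CubeRootOfUnity : Eisenstein → Set where
    one : CubeRootOfUnity 𝟙
    ω¹  : CubeRootOfUnity ω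
    ω²  : CubeRootOfUnity ⟨ -[1+ 0 ] , -[1+ 0 ] ⟩

  -- The six units are the powers of ω up to sign, and -1 is a cube.
  unit-mod-cubes : ∀ ε → ∣ norm ε ∣ ≡ 1 → ∃[ ζ ] ∃[ δ ] CubeRootOfUnity ζ × ε ≡ ζ ⊗ (δ ⊗ δ ⊗ δ)
  unit-mod-cubes ⟨ x , y ⟩ N≡1 = cases x y
    (square≤2 (ℕ.≤-trans (ℕ.m≤m+n _ _) (ℕ.m≤m+n _ _)))
    (square≤2 (ℕ.≤-trans (ℕ.m≤n+m (∣ y ∣ ℕ.* ∣ y ∣) (∣ x ∣ ℕ.* ∣ x ∣)) (ℕ.m≤m+n _ _)))
    sum≡2
    where
    sum≡2 : ∣ x ∣ ℕ.* ∣ x ∣ ℕ.+ ∣ y ∣ ℕ.* ∣ y ∣ ℕ.+ ∣ x - y ∣ ℕ.* ∣ x - y ∣ ≡ 2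
    sum≡2 = trans (sym (cong ∣_∣ (double-norm x y)))
      (trans (ℤ.abs-* (+ 2) (norm ⟨ x , y ⟩)) (cong (2 ℕ.*_) N≡1))
    square≤2 : ∀ {m} → m ℕ.≤ ∣ x ∣ ℕ.* ∣ x ∣ ℕ.+ ∣ y ∣ ℕ.* ∣ y ∣ ℕ.+ ∣ x - y ∣ ℕ.* ∣ x - y ∣ → m ℕ.≤ 2
    square≤2 {m} = subst (m ℕ.≤_) sum≡2
    big : ∀ m → ¬ suc (suc m) ℕ.* suc (suc m) ℕ.≤ 2
    big m m²≤2 with ℕ.≤-trans
      (ℕ.*-mono-≤ {2} {suc (suc m)} {2} {suc (suc m)} (s≤s (s≤s z≤n)) (s≤s (s≤s z≤n))) m²≤2
    ... | s≤s (s≤s ())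
    cases : ∀ x y → ∣ x ∣ ℕ.* ∣ x ∣ ℕ.≤ 2 → ∣ y ∣ ℕ.* ∣ y ∣ ℕ.≤ 2 →
      ∣ x ∣ ℕ.* ∣ x ∣ ℕ.+ ∣ y ∣ ℕ.* ∣ y ∣ ℕ.+ ∣ x - y ∣ ℕ.* ∣ x - y ∣ ≡ 2 →
      ∃[ ζ ] ∃[ δ ] CubeRootOfUnity ζ × ⟨ x , y ⟩ ≡ ζ ⊗ (δ ⊗ δ ⊗ δ)
    cases (+ 1) (+ 0) _ _ _ = _ , 𝟙 , one , refl
    cases (+ 0) (+ 1) _ _ _ = _ , 𝟙 , ω¹ , refl
    cases -[1+ 0 ] -[1+ 0 ] _ _ _ = _ , 𝟙 , ω² , refl
    cases -[1+ 0 ] (+ 0) _ _ _ = _ , ⊖ 𝟙 , one , refl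
    cases (+ 0) -[1+ 0 ] _ _ _ = _ , ⊖ 𝟙 , ω¹ , refl
    cases (+ 1) (+ 1) _ _ _ = _ , ⊖ 𝟙 , ω² , refl
    cases (+ 0) (+ 0) _ _ ()
    cases (+ 1) -[1+ 0 ] _ _ ()
    cases -[1+ 0 ] (+ 1) _ _ ()
    cases (+ suc (suc m)) _ x²≤2 _ _ = contradiction x²≤2 (big m)
    cases -[1+ suc m ] _ x²≤2 _ _ = contradiction x²≤2 (big m)
    cases _ (+ suc (suc m)) _ y²≤2 _ = contradiction y²≤2 (big m)
    cases _ -[1+ suc m ] _ y²≤2 _ = contradiction y²≤2 (big m)

  -- The cofactor of x - y in x³ - y³ is `norm ⟨ x , - y ⟩`, which vanishes only for x = y = 0.
  cube-injective : ∀ {x y} → x * x * x ≡ y * y * y → x ≡ y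
  cube-injective {x} {y} x³≡y³ =
    [ ℤ.i-j≡0⇒i≡j x y , (λ N≡0 → from-zero (norm≡0⇒≡𝟘 ⟨ x , - y ⟩ N≡0)) ]′
    (ℤ.i*j≡0⇒i≡0∨j≡0 (x - y) (trans (lemma x y) (ℤ.i≡j⇒i-j≡0 x³≡y³)))
    where
    lemma : ∀ x y → (x - y) * (x * x - x * - y + - y * - y) ≡ x * x * x - y * y * y
    lemma = solve-∀
    from-zero : ⟨ x , - y ⟩ ≡ 𝟘 → x ≡ y
    from-zero eq = trans (cong Eisenstein.re eq)
      (sym (ℤ.neg-injective {y} {0ℤ} (cong Eisenstein.im eq)))

  ℤ-unit : ∀ ε ε⁻¹ → ε * ε⁻¹ ≡ 1ℤ → ε ≡ 1ℤ ⊎ ε ≡ - 1ℤ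
  ℤ-unit ε ε⁻¹ unit = sign ε (ℕ.m*n≡1⇒m≡1 ∣ ε ∣ ∣ ε⁻¹ ∣ (trans (sym (ℤ.abs-* ε ε⁻¹)) (cong ∣_∣ unit)))
    where
    sign : ∀ ε → ∣ ε ∣ ≡ 1 → ε ≡ 1ℤ ⊎ ε ≡ - 1ℤ
    sign (+ 1)    refl = inj₁ refl
    sign -[1+ 0 ] refl = inj₂ refl

  -- The unit is ±1, hence a cube, and is absorbed into both roots by a simultaneous change of sign.
  ℤ-comaximal-cube : ∀ {a b c} → ¬ c ≡ 0ℤ → ℤ-Euclidean.Comaximal a b → a * b ≡ c * c * c →
    ∃[ l ] ∃[ n ] a ≡ l * l * l × b ≡ n * n * n × c ≡ l * n
  ℤ-comaximal-cube {a} {b} {c} c≢0 coprime ab≡c³ =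
    absorb (ℤ-Euclidean.comaximal-cube ℤ-cancel ℤ-bézout c≢0 coprime ab≡c³)
    where
    lemma₁ : ∀ g → - 1ℤ * (g * g * g) ≡ - g * - g * - g
    lemma₁ = solve-∀
    lemma₂ : ∀ b h → b - - h * - h * - h ≡ - 1ℤ * (- 1ℤ * b - h * h * h)
    lemma₂ = solve-∀
    lemma₃ : ∀ g h → g * h ≡ - g * - h
    lemma₃ = solve-∀
    absorb : (∃[ ε ] ∃[ ε⁻¹ ] ∃[ g ] ∃[ h ]
      ε * ε⁻¹ ≡ 1ℤ × a ≡ ε * (g * g * g) × ε * b ≡ h * h * h × c ≡ g * h) →
      ∃[ l ] ∃[ n ] a ≡ l * l * l × b ≡ n * n * n × c ≡ l * n
    absorb (ε , ε⁻¹ , g , h , unit , a≡ , εb≡ , c≡) with ℤ-unit ε ε⁻¹ unit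
    ... | inj₁ refl = g , h , trans a≡ (ℤ.*-identityˡ _) , trans (sym (ℤ.*-identityˡ b)) εb≡ , c≡
    ... | inj₂ refl = - g , - h , trans a≡ (lemma₁ g) ,
      from-eq (- 1ℤ) εb≡ (lemma₂ b h) , trans c≡ (lemma₃ g h)

  ⊗-conj : ∀ z → z ⊗ conj z ≡ ⟨ norm z , + 0 ⟩
  ⊗-conj ⟨ x , y ⟩ = cong₂ ⟨_,_⟩ (lemma-re x y) (lemma-im x y)
    where
    lemma-re : ∀ x y → x * (x - y) - y * - y ≡ x * x - x * y + y * y
    lemma-re = solve-∀
    lemma-im : ∀ x y → x * - y + y * (x - y) - y * - y ≡ + 0
    lemma-im = solve-∀

  embed-cube : ∀ n → ⟨ n * n * n , + 0 ⟩ ≡ ⟨ n , + 0 ⟩ ⊗ ⟨ n , + 0 ⟩ ⊗ ⟨ n , + 0 ⟩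
  embed-cube n = cong₂ ⟨_,_⟩ (lemma-re n) (lemma-im n)
    where
    lemma-re : ∀ n → n * n * n ≡ (n * n - + 0 * + 0) * n - (n * + 0 + + 0 * n - + 0 * + 0) * + 0
    lemma-re = solve-∀
    lemma-im : ∀ n → + 0 ≡ (n * n - + 0 * + 0) * + 0 + (n * + 0 + + 0 * n - + 0 * + 0) * n
      - (n * + 0 + + 0 * n - + 0 * + 0) * + 0
    lemma-im = solve-∀

  -- Here z and its conjugate are comaximal with product n³. The unit can be normalised only modulo
  -- cubes, which leaves ζ. Since ζ has norm 1, taking norms gives n³ = (norm γ)³, and cubing is
  -- injective on ℤ.
  norm-cube : ∀ {z n} → ¬ n ≡ 0ℤ → 𝔼-Euclidean.Comaximal z (conj z) → norm z ≡ n * n * n →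
    ∃[ ζ ] ∃[ γ ] CubeRootOfUnity ζ × z ≡ ζ ⊗ (γ ⊗ γ ⊗ γ) × n ≡ norm γ
  norm-cube {z} {n} n≢0 coprime N≡n³ =
    absorb (𝔼-Euclidean.comaximal-cube 𝔼-cancel 𝔼-bézout {z} {conj z} {⟨ n , + 0 ⟩} (λ eq →
      n≢0 (cong Eisenstein.re eq)) coprime
             (trans (⊗-conj z) (trans (cong ⟨_, + 0 ⟩ N≡n³) (embed-cube n))))
    where
    open ≡-Reasoning
    norm-root : ∀ {ζ} → CubeRootOfUnity ζ → norm ζ ≡ 1ℤ
    norm-root one = refl
    norm-root ω¹  = refl
    norm-root ω²  = refl
    norm-unit : ∀ ε ε⁻¹ → ε ⊗ ε⁻¹ ≡ 𝟙 → ∣ norm ε ∣ ≡ 1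
    norm-unit ε ε⁻¹ unit = ℕ.m*n≡1⇒m≡1 ∣ norm ε ∣ ∣ norm
      ε⁻¹ ∣ (trans (sym (ℤ.abs-* (norm ε) (norm ε⁻¹)))
      (cong ∣_∣ (trans (sym (norm-⊗ ε ε⁻¹)) (cong norm unit))))
    n≡norm : ∀ {ζ} γ → CubeRootOfUnity ζ → z ≡ ζ ⊗ (γ ⊗ γ ⊗ γ) → n ≡ norm γ
    n≡norm {ζ} γ root z≡ζγ³ = cube-injective (begin
      n * n * n                         ≡⟨ N≡n³ ⟨
      norm z                            ≡⟨ cong norm z≡ζγ³ ⟩
      norm (ζ ⊗ (γ ⊗ γ ⊗ γ))            ≡⟨ norm-⊗ ζ (γ ⊗ γ ⊗ γ) ⟩
      norm ζ * norm (γ ⊗ γ ⊗ γ)         ≡⟨ cong₂ _*_ (norm-root root)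
                                             (trans (norm-⊗ (γ ⊗ γ) γ)
                                               (cong (_* norm γ) (norm-⊗ γ γ))) ⟩
      1ℤ * (norm γ * norm γ * norm γ)   ≡⟨ ℤ.*-identityˡ _ ⟩
      norm γ * norm γ * norm γ          ∎)
    absorb-unit : ∀ {ε} g → z
      ≡ ε ⊗ (g ⊗ g ⊗ g) → (∃[ ζ ] ∃[ δ ] CubeRootOfUnity ζ × ε ≡ ζ ⊗ (δ ⊗ δ ⊗ δ)) →
      ∃[ ζ ] ∃[ γ ] CubeRootOfUnity ζ × z ≡ ζ ⊗ (γ ⊗ γ ⊗ γ) × n ≡ norm γ
    absorb-unit g z≡εg³ (ζ , δ , root , ε≡ζδ³) = ζ , δ ⊗ g , root , z≡ζγ³ , n≡norm (δ ⊗ g) root z≡ζγ³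
      where
      z≡ζγ³ : z ≡ ζ ⊗ (δ ⊗ g ⊗ (δ ⊗ g) ⊗ (δ ⊗ g))
      z≡ζγ³ = trans z≡εg³ (trans (cong (_⊗ (g ⊗ g ⊗ g)) ε≡ζδ³) (𝔼-Euclidean.*-cubes ζ δ g))
    absorb : (∃[ ε ] ∃[ ε⁻¹ ] ∃[ g ] ∃[ h ]
      ε ⊗ ε⁻¹ ≡ 𝟙 × z ≡ ε ⊗ (g ⊗ g ⊗ g) × ε ⊗ conj z ≡ h ⊗ h ⊗ h × ⟨ n , + 0 ⟩ ≡ g ⊗ h) →
      ∃[ ζ ] ∃[ γ ] CubeRootOfUnity ζ × z ≡ ζ ⊗ (γ ⊗ γ ⊗ γ) × n ≡ norm γ
    absorb (ε , ε⁻¹ , g , h , unit , z≡εg³ , _) =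
      absorb-unit g z≡εg³ (unit-mod-cubes ε (norm-unit ε ε⁻¹ unit))

  -- Prime divisors, coprimality and congruences modulo 3 and 9.

  prime[3] : Prime 3
  prime[3] = from-yes (prime? 3)

  prime-∣* : ∀ {p} → Prime p → ∀ x y → + p ∣ x * y → (+ p ∣ x) ⊎ (+ p ∣ y)
  prime-∣* {p} p-prime x y p∣xy = Sum.map ∣ᵤ⇒∣ ∣ᵤ⇒∣
    (euclidsLemma ∣ x ∣ ∣ y ∣ p-prime (subst (p ℕ.∣_) (ℤ.abs-* x y) (∣⇒∣ᵤ p∣xy)))

  prime-∣cube : ∀ {p} → Prime p → ∀ x → + p ∣ x * x * x → + p ∣ x
  prime-∣cube p-prime x p∣x³ =
    [ (λ p∣x² → [ (λ p∣x → p∣x) , (λ p∣x → p∣x) ]′ (prime-∣* p-prime x x p∣x²)) , (λ p∣x → p∣x) ]′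
    (prime-∣* p-prime (x * x) x p∣x³)

  -- Formulated with primes because the arguments of the descent run prime by prime;
  -- `coprime⇒comaximal` converts it to the Bézout form from which cube roots are extracted.
  Coprime : ℤ → ℤ → Set
  Coprime a b = ∀ {p} → Prime p → + p ∣ a → + p ∣ b → ⊥

  prime-divisor : ∀ n → n ≡ 1 ⊎ (∃[ p ] Prime p × p ℕ.∣ n)
  -- The prime 2 serves for 0, so that a vanishing gcd falls under the second alternative.
  prime-divisor 0 = inj₂ (2 , prime[2] , 2 ℕ.∣0)
  prime-divisor n@(suc _) = from-factors factors factorsPrime isFactorisation
    where
    open PrimeFactorisation (factorise n)
    from-factors : ∀ ps → All Prime ps → n ≡ product ps → n ≡ 1 ⊎ (∃[ p ] Prime p × p ℕ.∣ n)
    from-factors [] _ n≡1 = inj₁ n≡1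
    from-factors (p ∷ ps) (p-prime ∷ _) n≡ =
      inj₂ (p , p-prime , subst (p ℕ.∣_) (sym n≡) (ℕ.m∣m*n (product ps)))

  coprime⇒comaximal : ∀ {a b} → Coprime a b → ℤ-Euclidean.Comaximal a b
  coprime⇒comaximal {a} {b} coprime = [ unit-gcd , common-prime ]′ (prime-divisor ∣ gcd ∣)
    where
    open ℤ-Euclidean.Bézout (ℤ-bézout a b)
    lemma : ∀ g x y a b → g * x * a + g * y * b ≡ g * (x * a + y * b)
    lemma = solve-∀
    unit-square : ∀ g → ∣ g ∣ ≡ 1 → g * g ≡ 1ℤ
    unit-square (+ 1)    refl = refl
    unit-square -[1+ 0 ] refl = refl
    unit-gcd : ∣ gcd ∣ ≡ 1 → ℤ-Euclidean.Comaximal a b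
    -- The gcd is ±1 and thus its own inverse.
    unit-gcd g≡1 = gcd * x , gcd * y ,
      trans (lemma gcd x y a b) (trans (cong (gcd *_) (sym identity)) (unit-square gcd g≡1))
    common-prime : (∃[ p ] Prime p × p ℕ.∣ ∣ gcd ∣) → ℤ-Euclidean.Comaximal a b
    common-prime (p , p-prime , p∣g) = ⊥-elim (coprime p-prime
      (∣-trans (∣ᵤ⇒∣ p∣g) (divides a/gcd (trans gcd∣a (ℤ.*-comm gcd a/gcd))))
      (∣-trans (∣ᵤ⇒∣ p∣g) (divides b/gcd (trans gcd∣b (ℤ.*-comm gcd b/gcd)))))

  *≢0 : ∀ {x y} → ¬ x * y ≡ 0ℤ → ¬ x ≡ 0ℤ × ¬ y ≡ 0ℤ
  *≢0 {x} {y} xy≢0 = (λ { refl → xy≢0 (ℤ.*-zeroˡ y) }) , (λ { refl → xy≢0 (ℤ.*-zeroʳ x) })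

  coprime-* : ∀ {a} b c → Coprime a b → Coprime a c → Coprime a (b * c)
  coprime-* b c coprime-b coprime-c p-prime p∣a p∣bc =
    [ coprime-b p-prime p∣a , coprime-c p-prime p∣a ]′ (prime-∣* p-prime b c p∣bc)

  -- The roots are kept normalised so that their product is exactly k: this is what turns the linear
  -- term 9k into 9abc.
  three-cubes : ∀ {x y z k} → ¬ k ≡ 0ℤ → Coprime x y → Coprime x z → Coprime y z →
    x * y * z ≡ k * k * k →
    ∃[ a ] ∃[ b ] ∃[ c ] x ≡ a * a * a × y ≡ b * b * b × z ≡ c * c * c × k ≡ a * (b * c)
  three-cubes {x} {y} {z} {k} k≢0 xy xz yz xyz≡k³ = outer
    (ℤ-comaximal-cube {x} {y * z} {k} k≢0 (coprime⇒comaximal (coprime-* y z xy xz))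
      (trans (sym (ℤ.*-assoc x y z)) xyz≡k³))
    where
    Result = ∃[ a ] ∃[ b ] ∃[ c ] x ≡ a * a * a × y ≡ b * b * b × z ≡ c * c * c × k ≡ a * (b * c)
    inner : ∀ a e → x ≡ a * a * a → k ≡ a * e →
      (∃[ b ] ∃[ c ] y ≡ b * b * b × z ≡ c * c * c × e ≡ b * c) → Result
    inner a e x≡ k≡ (b , c , y≡ , z≡ , e≡) = a , b , c , x≡ , y≡ , z≡ , trans k≡ (cong (a *_) e≡)
    outer : (∃[ a ] ∃[ e ] x ≡ a * a * a × y * z ≡ e * e * e × k ≡ a * e) → Result
    outer (a , e , x≡ , yz≡ , k≡) = inner a e x≡ k≡
      (ℤ-comaximal-cube {y} {z} {e} (proj₂ (*≢0 {a} {e} (subst (λ i → ¬ i ≡ 0ℤ) k≡ k≢0)))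
        (coprime⇒comaximal yz) yz≡)

  fermat₃ : ∀ x → + 3 ∣ x * x * x - x
  fermat₃ x = from-residue (ℤ-residue x (+ 3))
    where
    lemma₀ : ∀ q → (+ 0 + q * + 3) * (+ 0 + q * + 3) * (+ 0 + q * + 3) - (+ 0 + q * + 3)
      ≡ (+ 9 * q * q * q - q) * + 3
    lemma₀ = solve-∀
    lemma₁ : ∀ q → (+ 1 + q * + 3) * (+ 1 + q * + 3) * (+ 1 + q * + 3) - (+ 1 + q * + 3)
      ≡ (+ 9 * q * q * q + + 9 * q * q + + 2 * q) * + 3
    lemma₁ = solve-∀
    lemma₂ : ∀ q → (+ 2 + q * + 3) * (+ 2 + q * + 3) * (+ 2 + q * + 3) - (+ 2 + q * + 3)
      ≡ (+ 9 * q * q * q + + 18 * q * q + + 11 * q + + 2) * + 3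
    lemma₂ = solve-∀
    from-residue : (∃[ q ] ∃[ r ] x ≡ + r + q * + 3 × r ℕ.< 3) → + 3 ∣ x * x * x - x
    from-residue (q , 0 , refl , _) = divides (+ 9 * q * q * q - q) (lemma₀ q)
    from-residue (q , 1 , refl , _) = divides (+ 9 * q * q * q + + 9 * q * q + + 2 * q) (lemma₁ q)
    from-residue (q , 2 , refl , _) =
      divides (+ 9 * q * q * q + + 18 * q * q + + 11 * q + + 2) (lemma₂ q)
    from-residue (q , suc (suc (suc _)) , _ , s≤s (s≤s (s≤s ())))

  3∣3* : ∀ x → + 3 ∣ + 3 * x
  3∣3* x = divides x (ℤ.*-comm (+ 3) x)

  3*-cancel : ∀ {x y} → + 3 * x ≡ + 3 * y → x ≡ y
  3*-cancel = ℤ-cancel (+ 3) (λ ())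

  -- Modulo 9 the equation forces 3 ∣ (u + v)²; this excludes the unit factors ω and
  -- ω² in the descent.
  3∣norm : ∀ u v l → l * l * l - + 3 * l * norm ⟨ u , v ⟩ ≡ u * u * u + v * v * v - + 3 * u * u * v →
    + 3 ∣ norm ⟨ u , v ⟩
  3∣norm u v l eq = from-l (subst (+ 3 ∣_) (sym l-w≡)
    (∣m∣n⇒∣m+n (∣m∣n⇒∣m+n (3∣3* (l * norm ⟨ u , v ⟩ - u * u * v)) (fermat₃ u))
      (∣m∣n⇒∣m-n (fermat₃ v) (fermat₃ l))))
    where
    w = u + v
    diff : ∀ u v l n →
      l - (u + v) - (+ 3 * (l * n - u * u * v) + (u * u * u - u) + ((v * v * v - v) - (l * l * l - l)))
      ≡ 1ℤ * (l * l * l - + 3 * l * n - (u * u * u + v * v * v - + 3 * u * u * v))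
    diff = solve-∀
    expand : ∀ u v m → + 3 * (u * u * u + v * v * v - + 2 * u * u * v - u * v * v)
      - + 3 * (+ 3 * (m * ((u + v) * (u + v) - (u * u - u * v + v * v) + + 3 * m * (u + v + m))))
      ≡ - 1ℤ * ((m * + 3 + (u + v)) * (m * + 3 + (u + v)) * (m * + 3 + (u + v))
        - + 3 * (m * + 3 + (u + v)) * (u * u - u * v + v * v)
        - (u * u * u + v * v * v - + 3 * u * u * v))
    expand = solve-∀
    -- Put w = u + v. Modulo 3 the cubic in the first bracket is w³ + u³ - uw². By Fermat's little
    -- theorem w times it is w², and the norm is congruent to w² as well.
    target : ∀ u v → u * u - u * v + v * v ≡
      ((u + v) * (u * u * u + v * v * v - + 2 * u * u * v - u * v * v)
        - (u + v) * ((u + v) * (u + v) * (u + v) - (u + v)) - (u + v) * (u * u * u - u)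
        + u * ((u + v) * (u + v) * (u + v) - (u + v)))
          - + 3 * ((u + v) * ((u + v) * u * u - (u + v) * (u + v) * u) + u * v)
    target = solve-∀
    l-w≡ : l - w ≡ + 3 * (l * norm ⟨ u , v ⟩ - u * u * v) + (u * u * u - u)
      + ((v * v * v - v) - (l * l * l - l))
    l-w≡ = from-eq 1ℤ eq (diff u v l (norm ⟨ u , v ⟩))
    from-l : + 3 ∣ l - w → + 3 ∣ norm ⟨ u , v ⟩
    from-l (divides m m≡) = subst (+ 3 ∣_) (sym (target u v))
      (∣m∣n⇒∣m-n (∣m∣n⇒∣m+n (∣m∣n⇒∣m-n (∣m∣n⇒∣m-n
        (∣n⇒∣m*n w (subst (+ 3 ∣_) (sym X≡)
          (3∣3* (m * (w * w - norm ⟨ u , v ⟩ + + 3 * m * (w + m)))))) (∣n⇒∣m*n w (fermat₃ w)))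
          (∣n⇒∣m*n w (fermat₃ u)))
        (∣n⇒∣m*n u (fermat₃ w))) (3∣3* (w * (w * u * u - w * w * u) + u * v)))
      where
      l≡ : l ≡ m * + 3 + w
      l≡ = from-eq 1ℤ m≡ (rearrange l w m)
        where
        rearrange : ∀ l w m → l - (m * + 3 + w) ≡ 1ℤ * (l - w - m * + 3)
        rearrange = solve-∀
      X≡ : u * u * u + v * v * v - + 2 * u * u * v - u * v * v
        ≡ + 3 * (m * (w * w - norm ⟨ u , v ⟩ + + 3 * m * (w + m)))
      X≡ = 3*-cancel (from-eq (- 1ℤ)
        (subst (λ l → l * l * l - + 3 * l * norm ⟨ u , v ⟩
        ≡ u * u * u + v * v * v - + 3 * u * u * v) l≡ eq)
        (expand u v m))

  -- The two integers are the trace z + conj z and the norm z · conj z. The combination x(z + conj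
  -- z) + y z · conj z regroups as (x + y conj z) z + x conj z.
  comaximal-conj : ∀ α β → ℤ-Euclidean.Comaximal (+ 2 * α - β) (norm ⟨ α , β ⟩) →
    𝔼-Euclidean.Comaximal ⟨ α , β ⟩ (conj ⟨ α , β ⟩)
  comaximal-conj α β (x , y , xt+yN≡1) = ⟨ x + y * (α - β) , - y * β ⟩ , ⟨ x , + 0 ⟩ ,
    cong₂ ⟨_,_⟩ (trans (lemma-re x y α β) xt+yN≡1) (lemma-im x y α β)
    where
    lemma-re : ∀ x y α β → (x + y * (α - β)) * α - - y * β * β + (x * (α - β) - + 0 * - β)
      ≡ x * (+ 2 * α - β) + y * (α * α - α * β + β * β)
    lemma-re = solve-∀
    lemma-im : ∀ x y α β → (x + y * (α - β)) * β + - y * β * α - - y * β * β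
      + (x * - β + + 0 * (α - β) - + 0 * - β) ≡ + 0
    lemma-im = solve-∀

  -- The descent step through ℤ[ω].

  record Solution (A B C k : ℤ) : Set where
    constructor solution
    field
      sum  : A + B + C ≡ + 9 * k
      prod : A * B * C ≡ + 18 * (k * k * k)

  -- The factor 3 makes the new k a proper divisor of a nonzero c even when m = ±1.
  record Smaller (c : ℤ) : Set where
    field
      k m A B C : ℤ
      c≡        : c ≡ k * (+ 3 * m)
      solves    : Solution A B C k

  -- For a + b = 3s the equation a³ + b³ + 18c³ = 9abc reads LN = c³.
  module Descent (a s c : ℤ) (c≢0 : ¬ c ≡ 0ℤ)
    (coprime-a : Coprime a (+ 18 * c)) (coprime-b : Coprime (s * + 3 - a) (+ 18 * c))
    (eq : a * a * a + (s * + 3 - a) * (s * + 3 - a) * (s * + 3 - a) + + 18 * (c * c * c)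
      ≡ + 9 * (a * (s * + 3 - a) * c)) where

    b = s * + 3 - a
    L = s + c
    N = + 3 * (s * s - s * c + c * c) - a * b

    -- Adding 9c³ completes the left side to a³ + b³ + (3c)³ - 3ab(3c), which is (a + b + 3c) times
    -- the norm of (a - 3c) + (b - 3c)ω. These two factors are 3L and 3N.
    LN≡c³ : L * N ≡ c * c * c
    LN≡c³ = ℤ-cancel (+ 9) (λ ()) (from-eq 1ℤ eq (lemma a s c))
      where
      lemma : ∀ a s c →
        + 9 * ((s + c) * (+ 3 * (s * s - s * c + c * c) - a * (s * + 3 - a))) - + 9 * (c * c * c)
        ≡ 1ℤ * (a * a * a + (s * + 3 - a) * (s * + 3 - a) * (s * + 3 - a) + + 18 * (c * c * c)
          - + 9 * (a * (s * + 3 - a) * c))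
      lemma = solve-∀

    ∤ab : ∀ {p} → Prime p → + p ∣ + 18 * c → + p ∣ a * b → ⊥
    ∤ab p-prime p∣18c p∣ab = [ (λ p∣a → coprime-a p-prime p∣a p∣18c)
      , (λ p∣b → coprime-b p-prime p∣b p∣18c) ]′
      (prime-∣* p-prime a b p∣ab)

    3∣18c : + 3 ∣ + 18 * c
    3∣18c = divides (+ 6 * c) (lemma c)
      where
      lemma : ∀ c → + 18 * c ≡ + 6 * c * + 3
      lemma = solve-∀

    N-ab : ∀ {p} → + p ∣ N → + p ∣ + 3 * (s * s - s * c + c * c) → + p ∣ a * b
    N-ab {p} p∣N p∣M = subst (+ p ∣_) (lemma (+ 3 * (s * s - s * c + c * c)) (a * b))
      (∣m∣n⇒∣m-n p∣M p∣N)
      where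
      lemma : ∀ m x → m - (m - x) ≡ x
      lemma = solve-∀

    coprime-LN : Coprime L N
    coprime-LN {p} p-prime p∣L p∣N =
      ∤ab p-prime (∣n⇒∣m*n (+ 18) p∣c) (N-ab p∣N (∣n⇒∣m*n (+ 3) (∣m∣n⇒∣m+n (∣m∣n⇒∣m-n
      (∣n⇒∣m*n s p∣s) (∣m⇒∣m*n c p∣s)) (∣m⇒∣m*n c p∣c))))
      where
      p∣c : + p ∣ c
      p∣c = prime-∣cube p-prime c (subst (+ p ∣_) LN≡c³ (∣m⇒∣m*n N p∣L))
      p∣s : + p ∣ s
      p∣s = ∣m+n∣n⇒∣m p∣L p∣c

    -- N ≡ -ab modulo 3, while 3 divides 18c. The units ω and ω² will be refuted by this.
    3∤N : ¬ + 3 ∣ N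
    3∤N 3∣N = ∤ab prime[3] 3∣18c (N-ab 3∣N (3∣3* (s * s - s * c + c * c)))

    -- z = ((a − 3c) + (b − 3c)ω) / (1 − ω) has norm N and trace t.
    α = a - c - s
    β = s - + 2 * c
    z = ⟨ α , β ⟩
    t = + 2 * a - + 3 * s

    norm-z : norm z ≡ N
    norm-z = lemma a s c
      where
      lemma : ∀ a s c → (a - c - s) * (a - c - s) - (a - c - s) * (s - + 2 * c)
        + (s - + 2 * c) * (s - + 2 * c)
        ≡ + 3 * (s * s - s * c + c * c) - a * (s * + 3 - a)
      lemma = solve-∀

    module _ (l n : ℤ) (L≡l³ : L ≡ l * l * l) (N≡n³ : N ≡ n * n * n) (c≡ln : c ≡ l * n) where

      n≢0 : ¬ n ≡ 0ℤ
      n≢0 = proj₂ (*≢0 {l} {n} (subst (λ i → ¬ i ≡ 0ℤ) c≡ln c≢0))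

      -- Modulo the trace t one has β ≡ 2α, so the norm becomes 3α². A common prime thus divides 3
      -- or α, and in either case it divides a as well as c. The third factor α is inserted to fit
      -- `prime-∣cube`.
      coprime-tn : Coprime t (n * n * n)
      coprime-tn {p} p-prime p∣t p∣n³ = [ p∤3 , p∤α ]′ (prime-∣* p-prime (+ 3) (α * α * α) (∣3α³))
        where
        p∣c : + p ∣ c
        p∣c = subst (+ p ∣_) (sym c≡ln) (∣n⇒∣m*n l (prime-∣cube p-prime n p∣n³))
        p∤a : ¬ + p ∣ a
        p∤a p∣a = coprime-a p-prime p∣a (∣n⇒∣m*n (+ 18) p∣c)
        ∣3α³ : + p ∣ + 3 * (α * α * α)
        ∣3α³ = subst (+ p ∣_) (sym (lemma a s c)) (∣n⇒∣m*n α (∣m∣n⇒∣m-n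
          (subst (+ p ∣_) (sym (trans norm-z N≡n³)) p∣n³) (∣m⇒∣m*n (t - + 3 * α) p∣t)))
          where
          lemma : ∀ a s c → + 3 * ((a - c - s) * (a - c - s) * (a - c - s)) ≡ (a - c - s) *
            ((a - c - s) * (a - c - s) - (a - c - s) * (s - + 2 * c) + (s - + 2 * c) * (s - + 2 * c)
              - (+ 2 * a - + 3 * s) * (+ 2 * a - + 3 * s - + 3 * (a - c - s)))
          lemma = solve-∀
        p∤3 : ¬ + p ∣ + 3
        p∤3 p∣3 = p∤a (subst (+ p ∣_) (lemma a s) (∣m∣n⇒∣m-n (∣m⇒∣m*n (a - s) p∣3) p∣t))
          where
          lemma : ∀ a s → + 3 * (a - s) - (+ 2 * a - + 3 * s) ≡ a
          lemma = solve-∀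
        p∤α : ¬ + p ∣ α * α * α
        p∤α p∣α³ = p∤a (subst (+ p ∣_) (lemma a s c)
          (∣m∣n⇒∣m+n (∣m∣n⇒∣m-n (∣n⇒∣m*n (+ 3) (prime-∣cube p-prime α p∣α³)) p∣t) (∣n⇒∣m*n (+ 3) p∣c)))
          where
          lemma : ∀ a s c → + 3 * (a - c - s) - (+ 2 * a - + 3 * s) + + 3 * c ≡ a
          lemma = solve-∀

      -- β = L - 3c, so the ω-coordinate of z depends on l and n only; comparing it with that of ζγ³
      -- eliminates a and s.
      β≡ : β ≡ l * l * l - + 3 * l * n
      β≡ = from-eqs 1ℤ (- + 3) L≡l³ c≡ln (lemma s c l n)
        where
        lemma : ∀ s c l n → s - + 2 * c - (l * l * l - + 3 * l * n)
          ≡ 1ℤ * (s + c - l * l * l) + - + 3 * (c - l * n)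
        lemma = solve-∀

      comaximal-z : 𝔼-Euclidean.Comaximal z (conj z)
      comaximal-z = comaximal-conj α β
        (subst₂ ℤ-Euclidean.Comaximal (lemma a s c) (sym (trans norm-z N≡n³))
        (coprime⇒comaximal coprime-tn))
        where
        lemma : ∀ a s c → + 2 * a - + 3 * s ≡ + 2 * (a - c - s) - (s - + 2 * c)
        lemma = solve-∀

      3∤norm : ∀ γ → n ≡ norm γ → ¬ + 3 ∣ norm γ
      3∤norm γ n≡ 3∣norm = 3∤N (subst (+ 3 ∣_) (sym N≡n³)
        (∣n⇒∣m*n (n * n) (subst (+ 3 ∣_) (sym n≡) 3∣norm)))

      -- Only ω-coordinates are compared. For ζ = 1 the one of γ³ is 3uv(u - v), whence 3 ∣ l; the
      -- other two units contradict `3∤N`.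
      descend-from : ∀ {ζ} u v → CubeRootOfUnity ζ → z ≡ ζ ⊗ (⟨ u , v ⟩ ⊗ ⟨ u , v ⟩ ⊗ ⟨ u , v ⟩) →
        n ≡ norm ⟨ u , v ⟩ → Smaller c
      descend-from u v one z≡ n≡ = smaller-from
        (prime-∣cube prime[3] l (subst (+ 3 ∣_) (sym l³≡)
          (3∣3* (l * norm ⟨ u , v ⟩ + u * v * (u - v)))))
        where
        lemma : ∀ u v l → l * l * l - + 3 * (l * (u * u - u * v + v * v) + u * v * (u - v))
          ≡ - 1ℤ * (+ 1 * ((u * u - v * v) * v + (u * v + v * u - v * v) * u
            - (u * v + v * u - v * v) * v)
              + + 0 * ((u * u - v * v) * u - (u * v + v * u - v * v) * v)
              - + 0 * ((u * u - v * v) * v + (u * v + v * u - v * v) * u - (u * v + v * u - v * v) * v)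
            - (l * l * l - + 3 * l * (u * u - u * v + v * v)))
        lemma = solve-∀
        β≡im = trans (sym (cong Eisenstein.im z≡)) (trans β≡ (cong (λ n → l * l * l - + 3 * l * n) n≡))
        l³≡ : l * l * l ≡ + 3 * (l * norm ⟨ u , v ⟩ + u * v * (u - v))
        l³≡ = from-eq (- 1ℤ) β≡im (lemma u v l)
        smaller-from : + 3 ∣ l → Smaller c
        -- The shifts -u, v, u - v have sum 0, second symmetric function -n and product -uv(u - v).
        -- At T = 3q = l the product ABC is therefore T³ - nT - uv(u - v). As T³ = 3(nT + uv(u -
        -- v)), this equals 2T³/3 = 18q³.
        smaller-from (divides q l≡) = record
          { k = q ; m = n ; A = + 3 * q - u ; B = + 3 * q + v ; C = + 3 * q - v + u
          ; c≡ = trans c≡ln (trans (cong (_* n) l≡) (rearrange q n))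
          ; solves = solution (sum q u v)
                     (3*-cancel (from-eq 1ℤ (subst (λ l → l * l * l
                       ≡ + 3 * (l * norm ⟨ u , v ⟩ + u * v * (u - v))) l≡ l³≡)
                         (prod q u v))) }
          where
          rearrange : ∀ q n → q * + 3 * n ≡ q * (+ 3 * n)
          rearrange = solve-∀
          sum : ∀ q u v → + 3 * q - u + (+ 3 * q + v) + (+ 3 * q - v + u) ≡ + 9 * q
          sum = solve-∀
          prod : ∀ q u v → + 3 * ((+ 3 * q - u) * (+ 3 * q + v) * (+ 3 * q - v + u))
            - + 3 * (+ 18 * (q * q * q))
            ≡ 1ℤ * (q * + 3 * (q * + 3) * (q * + 3)
              - + 3 * (q * + 3 * (u * u - u * v + v * v) + u * v * (u - v)))
          prod = solve-∀
      -- The ω-coordinate of ωγ³ is u³ + v³ - 3u²v.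
      descend-from u v ω¹ z≡ n≡ = ⊥-elim (3∤norm ⟨ u , v ⟩ n≡ (3∣norm u v l
        (from-eq (- 1ℤ) (trans (sym (cong Eisenstein.im z≡))
          (trans β≡ (cong (λ n → l * l * l - + 3 * l * n) n≡))) (lemma u v l))))
        where
        lemma : ∀ u v l → l * l * l - + 3 * l * (u * u - u * v + v * v)
          - (u * u * u + v * v * v - + 3 * u * u * v)
          ≡ - 1ℤ * (+ 0 * ((u * u - v * v) * v + (u * v + v * u - v * v) * u
            - (u * v + v * u - v * v) * v)
              + + 1 * ((u * u - v * v) * u - (u * v + v * u - v * v) * v)
              - + 1 * ((u * u - v * v) * v + (u * v + v * u - v * v) * u - (u * v + v * u - v * v) * v)
            - (l * l * l - + 3 * l * (u * u - u * v + v * v)))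
        lemma = solve-∀
      -- The ω-coordinate of ω²γ³ is -(u³ + v³ - 3uv²): the previous case with u and v exchanged and
      -- l replaced by -l.
      descend-from u v ω² z≡ n≡ = ⊥-elim (3∤norm ⟨ v , u ⟩ (trans n≡ (swap u v)) (3∣norm v u (- l)
        (from-eq 1ℤ (trans (sym (cong Eisenstein.im z≡))
          (trans β≡ (cong (λ n → l * l * l - + 3 * l * n) n≡))) (lemma u v l))))
        where
        swap : ∀ u v → u * u - u * v + v * v ≡ v * v - v * u + u * u
        swap = solve-∀
        lemma : ∀ u v l → - l * - l * - l - + 3 * - l * (v * v - v * u + u * u)
          - (v * v * v + u * u * u - + 3 * v * v * u)
          ≡ 1ℤ * (- + 1 * ((u * u - v * v) * v + (u * v + v * u - v * v) * u
            - (u * v + v * u - v * v) * v)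
              + - + 1 * ((u * u - v * v) * u - (u * v + v * u - v * v) * v)
              - - + 1 * ((u * u - v * v) * v + (u * v + v * u - v * v) * u
                - (u * v + v * u - v * v) * v)
            - (l * l * l - + 3 * l * (u * u - u * v + v * v)))
        lemma = solve-∀

      descend : (∃[ ζ ] ∃[ γ ] CubeRootOfUnity ζ × z ≡ ζ ⊗ (γ ⊗ γ ⊗ γ) × n ≡ norm γ) → Smaller c
      descend (ζ , ⟨ u , v ⟩ , root , z≡ , n≡) = descend-from u v root z≡ n≡

    smaller : Smaller c
    smaller = from-factors (ℤ-comaximal-cube {L} {N} {c} c≢0 (coprime⇒comaximal coprime-LN) LN≡c³)
      where
      from-factors : (∃[ l ] ∃[ n ] L ≡ l * l * l × N ≡ n * n * n × c ≡ l * n) → Smaller c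
      from-factors (l , n , L≡ , N≡ , c≡) =
        descend l n L≡ N≡ c≡ (norm-cube {z} {n} (n≢0 l n L≡ N≡ c≡) (comaximal-z l n L≡ N≡ c≡)
          (trans norm-z N≡))

  -- By Fermat's little theorem the equation modulo 3 reads a + b ≡ 0, which supplies the s of
  -- `Descent`.
  descent : ∀ {a b c} → ¬ c ≡ 0ℤ → Coprime a (+ 18 * c) → Coprime b (+ 18 * c) →
    a * a * a + b * b * b + + 18 * (c * c * c) ≡ + 9 * (a * b * c) → Smaller c
  descent {a} {b} {c} c≢0 coprime-a coprime-b eq = with-sum (subst (+ 3 ∣_) (lemma a b c)
      (∣m∣n⇒∣m-n (∣m∣n⇒∣m-n (subst (+ 3 ∣_) (sym eq′) (3∣3* (+ 3 * (a * b * c) - + 6 * (c * c * c))))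
        (fermat₃ a)) (fermat₃ b)))
    where
    eq′ : a * a * a + b * b * b ≡ + 3 * (+ 3 * (a * b * c) - + 6 * (c * c * c))
    eq′ = from-eq 1ℤ eq (rearrange a b c)
      where
      rearrange : ∀ a b c → a * a * a + b * b * b - + 3 * (+ 3 * (a * b * c) - + 6 * (c * c * c))
        ≡ 1ℤ * (a * a * a + b * b * b + + 18 * (c * c * c) - + 9 * (a * b * c))
      rearrange = solve-∀
    lemma : ∀ a b c → a * a * a + b * b * b - (a * a * a - a) - (b * b * b - b) ≡ a + b
    lemma = solve-∀
    with-sum : + 3 ∣ a + b → Smaller c
    with-sum (divides s a+b≡) = Descent.smaller a s c c≢0 coprime-a
      (subst (λ b → Coprime b (+ 18 * c)) b≡ coprime-b)
      (subst (λ b → a * a * a + b * b * b + + 18 * (c * c * c) ≡ + 9 * (a * b * c)) b≡ eq)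
      where
      b≡ : b ≡ s * + 3 - a
      b≡ = from-eq 1ℤ a+b≡ (rearrange a b s)
        where
        rearrange : ∀ a b s → b - (s * + 3 - a) ≡ 1ℤ * (a + b - s * + 3)
        rearrange = solve-∀

  -- The primes 2 and 3 in a minimal solution.

  factor-< : ∀ {k} q m → ¬ k ≡ 0ℤ → k ≡ q * m → 2 ℕ.≤ ∣ m ∣ → ∣ q ∣ ℕ.< ∣ k ∣
  factor-< {k} q m k≢0 k≡ 2≤m =
    subst (∣ q ∣ ℕ.<_) (sym (trans (cong ∣_∣ k≡) (ℤ.abs-* q m))) (ℕ.m<m*n ∣ q ∣ ∣ m ∣ 2≤m)
    where
    instance _ = ℤ.≢-nonZero (proj₁ (*≢0 {q} {m} (subst (λ i → ¬ i ≡ 0ℤ) k≡ k≢0)))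

  prime-∣18 : ∀ {p} → Prime p → + p ∣ + 18 → p ≡ 2 ⊎ p ≡ 3
  prime-∣18 {p} p-prime p∣18 = [ (λ p∣2 → inj₁ (divisor 2 prime[2] p∣2)) ,
      (λ p∣9 → inj₂ ([ divisor 3 prime[3] , divisor 3 prime[3] ]′ (prime-∣* p-prime (+ 3) (+ 3) p∣9)))
        ]′
    (prime-∣* p-prime (+ 2) (+ 9) p∣18)
    where
    divisor : ∀ q → Prime q → + p ∣ + q → p ≡ q
    divisor q q-prime p∣q = [ (λ p≡1 → contradiction (subst Prime p≡1 p-prime) ¬prime[1])
      , (λ p≡q → p≡q) ]′
      (prime⇒irreducible q-prime (∣⇒∣ᵤ p∣q))

  Primitive : (A B C k : ℤ) → Set
  Primitive A B C k = ∀ {p} → Prime p → + p ∣ A → + p ∣ B → + p ∣ C → + p ∣ k → ⊥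

  permute : ∀ {A B C k} → Solution A B C k → Solution B C A k
  permute {A} {B} {C} (solution sum prod) =
    solution (trans (lemma₁ A B C) sum) (trans (lemma₂ A B C) prod)
    where
    lemma₁ : ∀ A B C → B + C + A ≡ A + B + C
    lemma₁ = solve-∀
    lemma₂ : ∀ A B C → B * C * A ≡ A * B * C
    lemma₂ = solve-∀

  swap : ∀ {A B C k} → Solution A B C k → Solution B A C k
  swap {A} {B} {C} (solution sum prod) = solution (trans (lemma₁ A B C) sum) (trans (lemma₂ A B C) prod)
    where
    lemma₁ : ∀ A B C → B + A + C ≡ A + B + C
    lemma₁ = solve-∀
    lemma₂ : ∀ A B C → B * A * C ≡ A * B * C
    lemma₂ = solve-∀

  -- A common prime p of A and B divides 18k³. If p = 2, then 4 divides the product; if p = 3, the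
  -- sum puts 3 into C too and 27 divides the product. Either exceeds what 18 contains, so p divides
  -- k in every case, and then C.
  primitive⇒coprime : ∀ {A B C k} → Primitive A B C k → Solution A B C k → Coprime A B
  primitive⇒coprime {A} {B} {C} {k} prim (solution sum prod) {p} p-prime p∣A p∣B =
    prim p-prime p∣A p∣B p∣C p∣k
    where
    p∣k-of : p ≡ 2 ⊎ p ≡ 3 → + p ∣ k
    p∣k-of (inj₁ refl) = two p∣A p∣B
      where
      two : + 2 ∣ A → + 2 ∣ B → + 2 ∣ k
      two (divides a A≡) (divides b B≡) =
        [ (λ 2∣9 → contradiction 2∣9 (from-no (+ 2 ∣? + 9))) , prime-∣cube prime[2] k ]′
        (prime-∣* prime[2] (+ 9) (k * k * k) (divides (a * b * C) (ℤ-cancel (+ 2) (λ ())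
          (from-eq (- 1ℤ) (subst₂ (λ A B → A * B * C ≡ + 18 * (k * k * k)) A≡ B≡ prod)
            (lemma a b C k)))))
        where
        lemma : ∀ a b C k → + 2 * (+ 9 * (k * k * k)) - + 2 * (a * b * C * + 2)
          ≡ - 1ℤ * (a * + 2 * (b * + 2) * C - + 18 * (k * k * k))
        lemma = solve-∀
    p∣k-of (inj₂ refl) = three p∣A p∣B
      where
      three : + 3 ∣ A → + 3 ∣ B → + 3 ∣ k
      three (divides a A≡) (divides b B≡) =
        [ (λ 3∣2 → contradiction 3∣2 (from-no (+ 3 ∣? + 2))) , prime-∣cube prime[3] k ]′
        (prime-∣* prime[3] (+ 2) (k * k * k) (divides (a * b * c) (ℤ-cancel (+ 9) (λ ())
          (from-eq (- 1ℤ) (trans (cong (a * + 3 * (b * + 3) *_) (sym C≡))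
            (subst₂ (λ A B → A * B * C ≡ + 18 * (k * k * k)) A≡ B≡ prod)) (lemma a b c k)))))
        where
        c = + 3 * k - a - b
        C≡ : C ≡ c * + 3
        C≡ = from-eq 1ℤ (subst₂ (λ A B → A + B + C ≡ + 9 * k) A≡ B≡ sum) (rearrange a b C k)
          where
          rearrange : ∀ a b C k → C - (+ 3 * k - a - b) * + 3 ≡ 1ℤ * (a * + 3 + b * + 3 + C - + 9 * k)
          rearrange = solve-∀
        lemma : ∀ a b c k → + 9 * (+ 2 * (k * k * k)) - + 9 * (a * b * c * + 3)
          ≡ - 1ℤ * (a * + 3 * (b * + 3) * (c * + 3) - + 18 * (k * k * k))
        lemma = solve-∀
    p∣k : + p ∣ k
    p∣k = [ (λ p∣18 → p∣k-of (prime-∣18 p-prime p∣18)) , prime-∣cube p-prime k ]′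
      (prime-∣* p-prime (+ 18) (k * k * k) (subst (+ p ∣_) prod (∣m⇒∣m*n C (∣m⇒∣m*n B p∣A))))
    p∣C : + p ∣ C
    p∣C = ∣m+n∣m⇒∣n (subst (+ p ∣_) (sym sum) (∣n⇒∣m*n (+ 9) p∣k)) (∣m∣n⇒∣m+n p∣A p∣B)

  module _ {A B C k : ℤ} (k≢0 : ¬ k ≡ 0ℤ) (prim : Primitive A B C k) (sol : Solution A B C k) where

    private
      coprime-AB : Coprime A B
      coprime-AB = primitive⇒coprime prim sol
      coprime-BC : Coprime B C
      coprime-BC = primitive⇒coprime {B} {C} {A} {k} (λ p-prime p∣B p∣C p∣A →
        prim p-prime p∣A p∣B p∣C) (permute sol)
      coprime-AC : Coprime A C
      coprime-AC p-prime p∣A p∣C =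
        primitive⇒coprime {C} {A} {B} {k} (λ p-prime p∣C p∣A p∣B → prim p-prime p∣A p∣B p∣C)
        (permute (permute sol)) p-prime p∣C p∣A

    -- By coprimality C alone carries the factor 9 of 18k³. Hence C = 18D, where A, B, D are
    -- pairwise coprime with product k³.
    18∣C⇒smaller : + 2 ∣ C → + 3 ∣ C → ∃[ d ] ∃[ e ] k ≡ d * e × ¬ e ≡ 0ℤ × Smaller e
    18∣C⇒smaller (divides C₁ C≡2C₁) 3∣C = step₁
      ([ (λ 3∣C₁ → 3∣C₁) , (λ 3∣2 → contradiction 3∣2 (from-no (+ 3 ∣? + 2))) ]′
        (prime-∣* prime[3] C₁ (+ 2) (subst (+ 3 ∣_) C≡2C₁ 3∣C)))
      where
      Result = ∃[ d ] ∃[ e ] k ≡ d * e × ¬ e ≡ 0ℤ × Smaller e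

      step₃ : ∀ D → C ≡ D * + 18 →
        (∃[ a ] ∃[ b ] ∃[ c ] A ≡ a * a * a × B ≡ b * b * b × D ≡ c * c * c × k ≡ a * (b * c)) → Result
      step₃ D C≡ (a , b , c , A≡ , B≡ , D≡ , k≡) = a * b , c , k≡abc , c≢0 ,
        descent {a} {b} {c} c≢0 (cube-coprime A a A≡ coprime-AC) (cube-coprime B b B≡ coprime-BC)
          (from-eqs 1ℤ (+ 9) sum′ k≡ (rearrange a b c k))
        where
        k≡abc : k ≡ a * b * c
        k≡abc = trans k≡ (sym (ℤ.*-assoc a b c))
        c≢0 : ¬ c ≡ 0ℤ
        c≢0 = proj₂ (*≢0 {a * b} {c} (subst (λ i → ¬ i ≡ 0ℤ) k≡abc k≢0))
        C≡c³ : C ≡ c * c * + 18 * c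
        C≡c³ = trans C≡ (trans (cong (_* + 18) D≡) (lemma c))
          where
          lemma : ∀ c → c * c * c * + 18 ≡ c * c * + 18 * c
          lemma = solve-∀
        C≡18c : C ≡ c * c * (+ 18 * c)
        C≡18c = trans C≡c³ (ℤ.*-assoc (c * c) (+ 18) c)
        cube-coprime : ∀ X x → X ≡ x * x * x → Coprime X C → Coprime x (+ 18 * c)
        cube-coprime X x X≡ coprime {p} p-prime p∣x p∣18c = coprime p-prime
          (subst (+ p ∣_) (sym X≡) (∣n⇒∣m*n (x * x) p∣x))
            (subst (+ p ∣_) (sym C≡18c) (∣n⇒∣m*n (c * c) p∣18c))
        sum′ : a * a * a + b * b * b + c * c * + 18 * c ≡ + 9 * k
        sum′ = trans (cong₂ _+_ (cong₂ _+_ (sym A≡) (sym B≡)) (sym C≡c³)) (Solution.sum sol)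
        rearrange : ∀ a b c k → a * a * a + b * b * b + + 18 * (c * c * c) - + 9 * (a * b * c)
          ≡ 1ℤ * (a * a * a + b * b * b + c * c * + 18 * c - + 9 * k) + + 9 * (k - a * (b * c))
        rearrange = solve-∀

      step₂ : ∀ C₂ → C ≡ C₂ * + 3 * + 2 → + 3 ∣ C₂ → Result
      step₂ C₂ C≡ (divides D C₂≡) =
        step₃ D C≡18D (three-cubes {A} {B} {D} {k} k≢0 coprime-AB (D-coprime A coprime-AC)
        (D-coprime B coprime-BC)
          (ℤ-cancel (+ 18) (λ ()) (from-eq 1ℤ
            (subst (λ C → A * B * C ≡ + 18 * (k * k * k)) C≡18D (Solution.prod sol)) (lemma A B D k))))
        where
        C≡18D : C ≡ D * + 18
        C≡18D = trans C≡ (trans (cong (λ i → i * + 3 * + 2) C₂≡) (assoc D))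
          where
          assoc : ∀ D → D * + 3 * + 3 * + 2 ≡ D * + 18
          assoc = solve-∀
        D-coprime : ∀ X → Coprime X C → Coprime X D
        D-coprime X coprime {p} p-prime p∣X p∣D =
          coprime p-prime p∣X (subst (+ p ∣_) (sym C≡18D) (∣m⇒∣m*n (+ 18) p∣D))
        lemma : ∀ A B D k → + 18 * (A * B * D) - + 18 * (k * k * k)
          ≡ 1ℤ * (A * B * (D * + 18) - + 18 * (k * k * k))
        lemma = solve-∀

      step₁ : + 3 ∣ C₁ → Result
      step₁ (divides C₂ C₁≡) = step₂ C₂ C≡
        ([ (λ 3∣AB → ⊥-elim ([ (λ 3∣A → coprime-AC prime[3] 3∣A 3∣C)
        , (λ 3∣B → coprime-BC prime[3] 3∣B 3∣C) ]′
          (prime-∣* prime[3] A B 3∣AB))) , (λ 3∣C₂ → 3∣C₂) ]′ (prime-∣* prime[3] (A * B) C₂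
            (divides (k * k * k) (ℤ-cancel (+ 6) (λ ())
              (from-eq 1ℤ (subst (λ C → A * B * C ≡ + 18 * (k * k * k)) C≡ (Solution.prod sol))
              (lemma A B C₂ k))))))
        where
        C≡ : C ≡ C₂ * + 3 * + 2
        C≡ = trans C≡2C₁ (cong (_* + 2) C₁≡)
        lemma : ∀ A B C₂ k → + 6 * (A * B * C₂) - + 6 * (k * k * k * + 3)
          ≡ 1ℤ * (A * B * (C₂ * + 3 * + 2) - + 18 * (k * k * k))
        lemma = solve-∀

    -- Here A = 9a³, B = b³, C = 2c³ and k = abc would follow, so b³ + 2c³ ≡ 0 modulo 9. Then b ≡
    -- -2c modulo 3, hence -6c³ ≡ 0 modulo 9, and 3 divides both A and C.
    2∣C⇒3∤A : + 2 ∣ C → + 3 ∣ A → ⊥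
    2∣C⇒3∤A (divides C₁ C≡2C₁) 3∣A@(divides A₁ A≡3A₁) = step₁
      ([ [ (λ 3∣A₁ → 3∣A₁) , (λ 3∣B → ⊥-elim (coprime-AB prime[3] 3∣A 3∣B)) ]′
        , (λ 3∣C₁ → ⊥-elim (coprime-AC prime[3] 3∣A (3∣C 3∣C₁))) ]′
        (Sum.map₁ (prime-∣* prime[3] A₁ B) (prime-∣* prime[3] (A₁ * B) C₁
          (divides (k * k * k) (ℤ-cancel (+ 6) (λ ()) (from-eq 1ℤ prod₁ (lemma A₁ B C₁ k)))))))
      where
      prod₁ : A₁ * + 3 * B * (C₁ * + 2) ≡ + 18 * (k * k * k)
      prod₁ = subst₂ (λ A C → A * B * C ≡ + 18 * (k * k * k)) A≡3A₁ C≡2C₁ (Solution.prod sol)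
      lemma : ∀ A₁ B C₁ k → + 6 * (A₁ * B * C₁) - + 6 * (k * k * k * + 3)
        ≡ 1ℤ * (A₁ * + 3 * B * (C₁ * + 2) - + 18 * (k * k * k))
      lemma = solve-∀
      3∣C : + 3 ∣ C₁ → + 3 ∣ C
      3∣C 3∣C₁ = subst (+ 3 ∣_) (sym C≡2C₁) (∣m⇒∣m*n (+ 2) 3∣C₁)

      step₂ : ∀ D → A ≡ D * + 9 →
        (∃[ a ] ∃[ b ] ∃[ c ] D ≡ a * a * a × B ≡ b * b * b × C₁ ≡ c * c * c × k ≡ a * (b * c)) → ⊥
      step₂ D A≡9D (a , b , c , D≡ , B≡ , C₁≡ , k≡) = with-b 3∣b+2c
        where
        sum′ : a * a * a * + 9 + b * b * b + c * c * c * + 2 ≡ + 9 * k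
        sum′ = trans (cong₂ _+_ (cong₂ _+_ (trans (cong (_* + 9) (sym D≡)) (sym A≡9D)) (sym B≡))
          (trans (cong (_* + 2) (sym C₁≡)) (sym C≡2C₁))) (Solution.sum sol)
        cubic : b * b * b + + 2 * (c * c * c) ≡ + 3 * (+ 3 * (k - a * a * a))
        cubic = from-eq 1ℤ sum′ (rearrange a b c k)
          where
          rearrange : ∀ a b c k → b * b * b + + 2 * (c * c * c) - + 3 * (+ 3 * (k - a * a * a))
            ≡ 1ℤ * (a * a * a * + 9 + b * b * b + c * c * c * + 2 - + 9 * k)
          rearrange = solve-∀
        3∣b+2c : + 3 ∣ b + + 2 * c
        3∣b+2c = subst (+ 3 ∣_) (rearrange b c)
          (∣m∣n⇒∣m-n (∣m∣n⇒∣m-n (subst (+ 3 ∣_) (sym cubic) (3∣3* (+ 3 * (k - a * a * a))))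
          (fermat₃ b)) (∣n⇒∣m*n (+ 2) (fermat₃ c)))
          where
          rearrange : ∀ b c → b * b * b + + 2 * (c * c * c) - (b * b * b - b) - + 2 * (c * c * c - c)
            ≡ b + + 2 * c
          rearrange = solve-∀
        with-b : + 3 ∣ b + + 2 * c → ⊥
        with-b (divides m b+2c≡) =
          coprime-AC prime[3] 3∣A (3∣C (subst (+ 3 ∣_) (sym C₁≡) (∣n⇒∣m*n (c * c) 3∣c)))
          where
          b≡ : b ≡ m * + 3 - + 2 * c
          b≡ = from-eq 1ℤ b+2c≡ (rearrange b c m)
            where
            rearrange : ∀ b c m → b - (m * + 3 - + 2 * c) ≡ 1ℤ * (b + + 2 * c - m * + 3)
            rearrange = solve-∀
          2c³≡ : + 2 * (c * c * c) ≡
            + 3 * (+ 3 * (m * m * m) - + 6 * (m * m * c) + + 4 * (m * (c * c)) - (k - a * a * a))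
          2c³≡ = 3*-cancel (from-eq (- 1ℤ)
            (subst (λ b → b * b * b + + 2 * (c * c * c) ≡ + 3 * (+ 3 * (k - a * a * a))) b≡ cubic)
            (rearrange c m (k - a * a * a)))
            where
            rearrange : ∀ c m j → + 3 * (+ 2 * (c * c * c))
              - + 3 * (+ 3 * (+ 3 * (m * m * m) - + 6 * (m * m * c) + + 4 * (m * (c * c)) - j))
              ≡ - 1ℤ * ((m * + 3 - + 2 * c) * (m * + 3 - + 2 * c) * (m * + 3 - + 2 * c) +
                + 2 * (c * c * c) - + 3 * (+ 3 * j))
            rearrange = solve-∀
          3∣c : + 3 ∣ c
          3∣c = [ (λ 3∣2 → contradiction 3∣2 (from-no (+ 3 ∣? + 2))) , prime-∣cube prime[3] c ]′
            (prime-∣* prime[3] (+ 2) (c * c * c)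
              (subst (+ 3 ∣_) (sym 2c³≡)
              (3∣3* (+ 3 * (m * m * m) - + 6 * (m * m * c) + + 4 * (m * (c * c)) - (k - a * a * a)))))

      step₁ : + 3 ∣ A₁ → ⊥
      step₁ (divides D A₁≡) = step₂ D A≡9D (three-cubes {D} {B} {C₁} {k} k≢0
        (λ p-prime p∣D p∣B → coprime-AB p-prime (∣A p∣D) p∣B)
        (λ p-prime p∣D p∣C₁ → coprime-AC p-prime (∣A p∣D) (∣C p∣C₁))
        (λ p-prime p∣B p∣C₁ → coprime-BC p-prime p∣B (∣C p∣C₁))
        (ℤ-cancel (+ 18) (λ ()) (from-eq 1ℤ
          (subst₂ (λ A C → A * B * C ≡ + 18 * (k * k * k)) A≡9D C≡2C₁ (Solution.prod sol))
          (lemma′ D B C₁ k))))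
        where
        A≡9D : A ≡ D * + 9
        A≡9D = trans A≡3A₁ (trans (cong (_* + 3) A₁≡) (assoc D))
          where
          assoc : ∀ D → D * + 3 * + 3 ≡ D * + 9
          assoc = solve-∀
        ∣A : ∀ {p} → + p ∣ D → + p ∣ A
        ∣A {p} p∣D = subst (+ p ∣_) (sym A≡9D) (∣m⇒∣m*n (+ 9) p∣D)
        ∣C : ∀ {p} → + p ∣ C₁ → + p ∣ C
        ∣C {p} p∣C₁ = subst (+ p ∣_) (sym C≡2C₁) (∣m⇒∣m*n (+ 2) p∣C₁)
        lemma′ : ∀ D B C₁ k → + 18 * (D * B * C₁) - + 18 * (k * k * k)
          ≡ 1ℤ * (D * + 9 * B * (C₁ * + 2) - + 18 * (k * k * k))
        lemma′ = solve-∀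

  NoSmallerSolution : ℤ → Set
  NoSmallerSolution k = ∀ {A B C} q → ∣ q ∣ ℕ.< ∣ k ∣ → ¬ q ≡ 0ℤ → Solution A B C q → ⊥

  -- The system is homogeneous: a common prime can be divided out, which leaves a smaller nonzero k.
  minimal⇒primitive : ∀ {A B C k} → ¬ k ≡ 0ℤ → NoSmallerSolution k → Solution A B C k →
    Primitive A B C k
  minimal⇒primitive {A} {B} {C} {k} k≢0 minimal (solution sum prod) {p} p-prime (divides a A≡)
    (divides b B≡) (divides c C≡) (divides q k≡) =
    minimal {a} {b} {c} q (factor-< q (+ p) k≢0 k≡ (ℕ.nonTrivial⇒n>1 p))
      (proj₁ (*≢0 {q} {+ p} (subst (λ i → ¬ i ≡ 0ℤ) k≡ k≢0)))
      (solution (ℤ-cancel (+ p) p≢0 (from-eq 1ℤ sum′ (lemma₁ a b c q (+ p))))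
        (ℤ-cancel (+ p) p≢0 (ℤ-cancel (+ p) p≢0
          (ℤ-cancel (+ p) p≢0 (from-eq 1ℤ prod′ (lemma₂ a b c q (+ p)))))))
    where
    instance _ = prime⇒nonTrivial p-prime
    p≢0 : ¬ + p ≡ 0ℤ
    p≢0 p≡0 = proj₂ (*≢0 {q} {+ p} (subst (λ i → ¬ i ≡ 0ℤ) k≡ k≢0)) p≡0
    sum′ : a * + p + b * + p + c * + p ≡ + 9 * (q * + p)
    sum′ = trans (sym (cong₂ _+_ (cong₂ _+_ A≡ B≡) C≡)) (trans sum (cong (+ 9 *_) k≡))
    prod′ : a * + p * (b * + p) * (c * + p) ≡ + 18 * (q * + p * (q * + p) * (q * + p))
    prod′ = trans (sym (cong₂ _*_ (cong₂ _*_ A≡ B≡) C≡))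
      (trans prod (cong (λ k → + 18 * (k * k * k)) k≡))
    lemma₁ : ∀ a b c q p → p * (a + b + c) - p * (+ 9 * q)
      ≡ 1ℤ * (a * p + b * p + c * p - + 9 * (q * p))
    lemma₁ = solve-∀
    lemma₂ : ∀ a b c q p → p * (p * (p * (a * b * c))) - p * (p * (p * (+ 18 * (q * q * q))))
      ≡ 1ℤ * (a * p * (b * p) * (c * p) - + 18 * (q * p * (q * p) * (q * p)))
    lemma₂ = solve-∀

  -- The prime 3 divides one of A, B, C. The congruence modulo 9 rules out A and B, and the descent
  -- rules out C.
  minimal⇒2∤C : ∀ {A B C k} → ¬ k ≡ 0ℤ → NoSmallerSolution k → Solution A B C k → + 2 ∣ C → ⊥
  minimal⇒2∤C {A} {B} {C} {k} k≢0 minimal sol 2∣C =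
    [ [ 2∣C⇒3∤A k≢0 prim sol 2∣C
      , 2∣C⇒3∤A {B} {A} {C} {k} k≢0 (λ p-prime p∣B p∣A → prim p-prime p∣A p∣B) (swap sol) 2∣C ]′
    , (λ 3∣C → from-smaller (18∣C⇒smaller k≢0 prim sol 2∣C 3∣C)) ]′
    (Sum.map₁ (prime-∣* prime[3] A B)
      (prime-∣* prime[3] (A * B) C (divides (+ 6 * (k * k * k)) (trans (Solution.prod sol) (lemma k)))))
    where
    prim = minimal⇒primitive k≢0 minimal sol
    lemma : ∀ k → + 18 * (k * k * k) ≡ + 6 * (k * k * k) * + 3
    lemma = solve-∀
    from-smaller : (∃[ d ] ∃[ e ] k ≡ d * e × ¬ e ≡ 0ℤ × Smaller e) → ⊥
    from-smaller (d , e , k≡ , e≢0 , smaller) = minimal S.k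
      (factor-< S.k (+ 3 * (d * S.m)) k≢0 k≡′
        (2≤ (*≢0 {S.k} {+ 3 * (d * S.m)} (subst (λ i → ¬ i ≡ 0ℤ) k≡′ k≢0)))) q≢0 S.solves
      where
      module S = Smaller smaller
      rearrange : ∀ d q m → d * (q * (+ 3 * m)) ≡ q * (+ 3 * (d * m))
      rearrange = solve-∀
      k≡′ : k ≡ S.k * (+ 3 * (d * S.m))
      k≡′ = trans k≡ (trans (cong (d *_) S.c≡) (rearrange d S.k S.m))
      q≢0 : ¬ S.k ≡ 0ℤ
      q≢0 = proj₁ (*≢0 {S.k} {+ 3 * S.m} (subst (λ i → ¬ i ≡ 0ℤ) S.c≡ e≢0))
      2≤ : ∀ {x} → ¬ x ≡ 0ℤ × ¬ + 3 * (d * S.m) ≡ 0ℤ → 2 ℕ.≤ ∣ + 3 * (d * S.m) ∣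
      2≤ (_ , 3M≢0) = subst (2 ℕ.≤_) (sym (ℤ.abs-* (+ 3) (d * S.m)))
        (ℕ.≤-trans (s≤s (s≤s z≤n)) (ℕ.m≤m*n 3 ∣ d * S.m ∣))
        where instance _ = ℤ.≢-nonZero (proj₂ (*≢0 {+ 3} {d * S.m} 3M≢0))

  -- As 18k³ is even, one of the three numbers is even, and cyclic symmetry moves it to the place of
  -- C.
  no-solution : ∀ {A B C} k → Acc ℕ._<_ ∣ k ∣ → ¬ k ≡ 0ℤ → Solution A B C k → ⊥
  no-solution {A} {B} {C} k (acc rec) k≢0 sol =
    [ [ (λ 2∣A → minimal⇒2∤C {B} {C} {A} {k} k≢0 minimal (permute sol) 2∣A)
      , (λ 2∣B → minimal⇒2∤C {C} {A} {B} {k} k≢0 minimal (permute (permute sol)) 2∣B) ]′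
    , (λ 2∣C → minimal⇒2∤C {A} {B} {C} {k} k≢0 minimal sol 2∣C) ]′
    (Sum.map₁ (prime-∣* prime[2] A B)
      (prime-∣* prime[2] (A * B) C (divides (+ 9 * (k * k * k)) (trans (Solution.prod sol) (lemma k)))))
    where
    lemma : ∀ k → + 18 * (k * k * k) ≡ + 9 * (k * k * k) * + 2
    lemma = solve-∀
    minimal : NoSmallerSolution k
    minimal q q<k = no-solution q (rec q<k)

  solution⇒k≡0 : ∀ {A B C k} → Solution A B C k → k ≡ 0ℤ
  solution⇒k≡0 {k = k} sol with k ≟ 0ℤ
  ... | yes k≡0 = k≡0
  ... | no  k≢0 = ⊥-elim (no-solution k (<-wellFounded ∣ k ∣) k≢0 sol)

-- From integral to rational solutions.

open import Defs
open import Data.Integer.Base as ℤ using (ℤ) renaming (+_ to pos)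
import Data.Integer.Properties as ℤ
import Data.Integer.Tactic.RingSolver as ℤ-Solver
open import Data.Rational.Base as ℚ using (ℚ; _+_; _*_; _-_; -_; 0ℚ; ½; ↥_; ↧_)
open import Data.Rational.Literals using (fromℤ)
open import Data.Rational.Properties as ℚ using (_≟_)
open import Data.Rational.Unnormalised.Base using (*≡*)
import Data.Rational.Unnormalised.Properties as ℚᵘ
open import Algebra.Definitions.RawMagma using (module _∣ʳ_)
open import Tactic.RingSolver using (solve-∀)
open import Tactic.RingSolver.Core.AlmostCommutativeRing using (AlmostCommutativeRing; fromCommutativeRing)
open Integers using (Solution; solution; solution⇒k≡0)

ℚ-ring : AlmostCommutativeRing 0ℓ 0ℓ
ℚ-ring = fromCommutativeRing ℚ.+-*-commutativeRing (λ x → dec⇒maybe (0ℚ ≟ x))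

x-x≡0 : ∀ x → x - x ≡ 0
x-x≡0 = ℚ.+-inverseʳ

ℚ-from-eq : ∀ x y {l r} m → l ≡ r → x - y ≡ m * (l - r) → x ≡ y
ℚ-from-eq x y {l} m refl eq =
  trans (lemma x y) (trans (cong (_+ y) (trans eq (trans (cong (m *_) (x-x≡0 l)) (ℚ.*-zeroʳ m))))
  (ℚ.+-identityˡ y))
  where
  lemma : ∀ x y → x ≡ x - y + y
  lemma = solve-∀ ℚ-ring

ℚ-from-eqs : ∀ x y {l r l′ r′} m m′ → l ≡ r → l′ ≡ r′ → x - y ≡ m * (l - r) + m′ * (l′ - r′) → x ≡ y
ℚ-from-eqs x y {l} {r} {l′} m m′ eq₁ refl eq = ℚ-from-eq x y m eq₁ (trans eq
  (trans (cong (λ z → m * (l - r) + z) (trans (cong (m′ *_) (x-x≡0 l′)) (ℚ.*-zeroʳ m′)))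
    (ℚ.+-identityʳ _)))

ℚ-inverse : ∀ {x} → x ≢ 0 → ∃[ y ] x * y ≡ 1
ℚ-inverse {x} x≢0 = (ℚ.1/ x) , ℚ.*-inverseʳ x
  where instance _ = ℚ.≢-nonZero x≢0

ℚ-cancel : ∀ {x y} → x ≢ 0 → x * y ≡ 0 → y ≡ 0
ℚ-cancel {x} {y} x≢0 xy≡0 = from-inverse (ℚ-inverse x≢0)
  where
  lemma : ∀ x y z → y - 0 ≡ z * (x * y - 0) + - y * (x * z - 1)
  lemma = solve-∀ ℚ-ring
  from-inverse : (∃[ z ] x * z ≡ 1) → y ≡ 0
  from-inverse (z , xz≡1) = ℚ-from-eqs y 0 z (- y) xy≡0 xz≡1 (lemma x y z)

ℚ-zero-product : ∀ x y → x * y ≡ 0 → x ≡ 0 ⊎ y ≡ 0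
ℚ-zero-product x y xy≡0 with x ≟ 0
... | yes x≡0 = inj₁ x≡0
... | no  x≢0 = inj₂ (ℚ-cancel x≢0 xy≡0)

fromℤ-+ : ∀ i j → fromℤ (i ℤ.+ j) ≡ fromℤ i + fromℤ j
fromℤ-+ i j = ℚ.toℚᵘ-injective
  (ℚᵘ.≃-trans (*≡* (lemma i j)) (ℚᵘ.≃-sym (ℚ.toℚᵘ-homo-+ (fromℤ i) (fromℤ j))))
  where
  lemma : ∀ i j → (i ℤ.+ j) ℤ.* pos 1 ≡ (i ℤ.* pos 1 ℤ.+ j ℤ.* pos 1) ℤ.* pos 1
  lemma = ℤ-Solver.solve-∀

fromℤ-* : ∀ i j → fromℤ (i ℤ.* j) ≡ fromℤ i * fromℤ j
fromℤ-* i j = ℚ.toℚᵘ-injective (ℚᵘ.≃-trans (*≡* refl) (ℚᵘ.≃-sym (ℚ.toℚᵘ-homo-* (fromℤ i) (fromℤ j))))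

fromℤ-neg : ∀ i → fromℤ (ℤ.- i) ≡ - fromℤ i
fromℤ-neg i = ℚ.toℚᵘ-injective (ℚᵘ.≃-trans (*≡* refl) (ℚᵘ.≃-sym (ℚ.toℚᵘ-homo‿- (fromℤ i))))

fromℤ-injective : ∀ {i j} → fromℤ i ≡ fromℤ j → i ≡ j
fromℤ-injective eq = cong ↥_ eq

clear-denominator : ∀ x → fromℤ (↧ x) * x ≡ fromℤ (↥ x)
clear-denominator x@(ℚ.mkℚ n d-1 _) = ℚ.toℚᵘ-injective (ℚᵘ.≃-trans (ℚ.toℚᵘ-homo-* (fromℤ (↧ x)) x)
  (*≡* (trans (lemma (pos (suc d-1)) n) (cong (λ e → n ℤ.* pos (suc e)) (sym (ℕ.+-identityʳ d-1))))))
  where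
  lemma : ∀ d n → d ℤ.* n ℤ.* pos 1 ≡ n ℤ.* d
  lemma = ℤ-Solver.solve-∀

denominator≢0 : ∀ x → fromℤ (↧ x) ≢ 0
denominator≢0 x eq with fromℤ-injective {↧ x} {pos 0} eq
... | ()

*≢0 : ∀ {x y} → x ≢ 0 → y ≢ 0 → x * y ≢ 0
*≢0 x≢0 y≢0 xy≡0 = y≢0 (ℚ-cancel x≢0 xy≡0)

rational-solution⇒k≡0 : ∀ A B C k → A + B + C ≡ 9 * k → A * B * C ≡ 18 * (k * k * k) → k ≡ 0
rational-solution⇒k≡0 A B C k sum prod =
  ℚ-cancel D≢0 (trans (sym k′≡) (cong fromℤ (solution⇒k≡0 integral)))
  where
  dA = fromℤ (↧ A)
  dB = fromℤ (↧ B)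
  dk = fromℤ (↧ k)
  D = dA * dB * dk
  D≢0 : D ≢ 0
  D≢0 = *≢0 (*≢0 (denominator≢0 A) (denominator≢0 B)) (denominator≢0 k)
  A′ = ↥ A ℤ.* (↧ B ℤ.* ↧ k)
  B′ = ↥ B ℤ.* (↧ A ℤ.* ↧ k)
  k′ = ↥ k ℤ.* (↧ A ℤ.* ↧ B)
  -- The linear equation determines C, so the denominators of A, B and k suffice.
  C′ = pos 9 ℤ.* k′ ℤ.+ (ℤ.- A′ ℤ.+ ℤ.- B′)
  multiply : ∀ x i j → fromℤ (↥ x ℤ.* (i ℤ.* j)) ≡ fromℤ (↧ x) * x * (fromℤ i * fromℤ j)
  multiply x i j = trans (fromℤ-* (↥ x) (i ℤ.* j)) (cong₂ _*_ (sym (clear-denominator x)) (fromℤ-* i j))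
  A′≡ : fromℤ A′ ≡ D * A
  A′≡ = trans (multiply A (↧ B) (↧ k)) (lemma dA dB dk A)
    where
    lemma : ∀ a b k x → a * x * (b * k) ≡ a * b * k * x
    lemma = solve-∀ ℚ-ring
  B′≡ : fromℤ B′ ≡ D * B
  B′≡ = trans (multiply B (↧ A) (↧ k)) (lemma dA dB dk B)
    where
    lemma : ∀ a b k x → b * x * (a * k) ≡ a * b * k * x
    lemma = solve-∀ ℚ-ring
  k′≡ : fromℤ k′ ≡ D * k
  k′≡ = trans (multiply k (↧ A) (↧ B)) (lemma dA dB dk k)
    where
    lemma : ∀ a b k x → k * x * (a * b) ≡ a * b * k * x
    lemma = solve-∀ ℚ-ring
  C′≡ : fromℤ C′ ≡ D * C
  C′≡ = trans (fromℤ-+ (pos 9 ℤ.* k′) (ℤ.- A′ ℤ.+ ℤ.- B′))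
    (trans (cong₂ _+_ (trans (fromℤ-* (pos 9) k′) (cong (9 *_) k′≡))
      (trans (fromℤ-+ (ℤ.- A′) (ℤ.- B′))
        (cong₂ _+_ (trans (fromℤ-neg A′) (cong -_ A′≡)) (trans (fromℤ-neg B′) (cong -_ B′≡)))))
    (ℚ-from-eq _ _ (- D) sum (lemma D A B C k)))
    where
    lemma : ∀ D A B C k → 9 * (D * k) + (- (D * A) + - (D * B)) - D * C ≡ - D * (A + B + C - 9 * k)
    lemma = solve-∀ ℚ-ring
  integral : Solution A′ B′ C′ k′
  integral = solution (lemma A′ B′ k′) (fromℤ-injective (trans (fromℤ-* (A′ ℤ.* B′) C′)
      (trans (cong₂ _*_ (trans (fromℤ-* A′ B′) (cong₂ _*_ A′≡ B′≡)) C′≡)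
      (trans (ℚ-from-eq _ _ (D * D * D) prod (cubic D A B C k))
      (sym (trans (fromℤ-* (pos 18) (k′ ℤ.* k′ ℤ.* k′))
        (cong (18 *_) (trans (fromℤ-* (k′ ℤ.* k′) k′)
        (cong₂ _*_ (trans (fromℤ-* k′ k′) (cong₂ _*_ k′≡ k′≡)) k′≡)))))))))
    where
    lemma : ∀ A′ B′ k′ → A′ ℤ.+ B′ ℤ.+ (pos 9 ℤ.* k′ ℤ.+ (ℤ.- A′ ℤ.+ ℤ.- B′)) ≡ pos 9 ℤ.* k′
    lemma = ℤ-Solver.solve-∀
    cubic : ∀ D A B C k → D * A * (D * B) * (D * C) - 18 * (D * k * (D * k) * (D * k))
      ≡ D * D * D * (A * B * C - 18 * (k * k * k))
    cubic = solve-∀ ℚ-ring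

-- Polynomials as functionals on sequences.

Sequence : Set
Sequence = ℕ → ℚ

-- The linear functional xⁿ ↦ s n.
pair : Poly → Sequence → ℚ
pair []      s = 0
pair (a ∷ p) s = a * s 0 + pair p (s ∘ suc)

shift : ℕ → Sequence → Sequence
shift zero    s = s
shift (suc i) s = shift i (s ∘ suc)

pair-cong : ∀ p {s t} → (∀ n → s n ≡ t n) → pair p s ≡ pair p t
pair-cong []      s≗t = refl
pair-cong (a ∷ p) s≗t = cong₂ _+_ (cong (a *_) (s≗t 0)) (pair-cong p (λ n → s≗t (suc n)))

pair-≈0 : ∀ p → (∀ n → coeff p n ≡ 0) → ∀ s → pair p s ≡ 0
pair-≈0 []      p≈0 s = refl
pair-≈0 (a ∷ p) p≈0 s = trans (cong₂ _+_ (trans (cong (_* s 0) (p≈0 0)) (ℚ.*-zeroˡ (s 0)))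
  (pair-≈0 p (λ n → p≈0 (suc n)) (s ∘ suc))) refl

pair-zero : ∀ p → pair p (λ _ → 0) ≡ 0
pair-zero []      = refl
pair-zero (a ∷ p) = trans (cong₂ _+_ (ℚ.*-zeroʳ a) (pair-zero p)) refl

pair-≈ : ∀ p q → p ≈ q → ∀ s → pair p s ≡ pair q s
pair-≈ []      q       p≈q s = sym (pair-≈0 q (λ n → sym (p≈q n)) s)
pair-≈ (a ∷ p) []      p≈q s = pair-≈0 (a ∷ p) p≈q s
pair-≈ (a ∷ p) (b ∷ q) p≈q s =
  cong₂ _+_ (cong (_* s 0) (p≈q 0)) (pair-≈ p q (λ n → p≈q (suc n)) (s ∘ suc))

pair-+ : ∀ p q s → pair (p +ₚ q) s ≡ pair p s + pair q s
pair-+ []      q       s = sym (ℚ.+-identityˡ (pair q s))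
pair-+ (a ∷ p) []      s = sym (ℚ.+-identityʳ (pair (a ∷ p) s))
pair-+ (a ∷ p) (b ∷ q) s = trans (cong ((a + b) * s 0 +_) (pair-+ p q (s ∘ suc)))
  (lemma a b (s 0) (pair p (s ∘ suc)) (pair q (s ∘ suc)))
  where
  lemma : ∀ a b x y z → (a + b) * x + (y + z) ≡ a * x + y + (b * x + z)
  lemma = solve-∀ ℚ-ring

pair-scale : ∀ a p s → pair (map (a *_) p) s ≡ a * pair p s
pair-scale a []      s = sym (ℚ.*-zeroʳ a)
pair-scale a (b ∷ p) s = trans (cong (a * b * s 0 +_) (pair-scale a p (s ∘ suc)))
  (lemma a b (s 0) (pair p (s ∘ suc)))
  where
  lemma : ∀ a b x y → a * b * x + a * y ≡ a * (b * x + y)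
  lemma = solve-∀ ℚ-ring

-- Multiplication by q is adjoint to replacing s by the values of q on the shifts of s. Through
-- this, products and divisibility become statements about sequences.
pair-* : ∀ p q s → pair (p *ₚ q) s ≡ pair p (λ i → pair q (shift i s))
pair-* []      q s = refl
pair-* (a ∷ p) q s = trans (pair-+ (map (a *_) q) (0 ∷ p *ₚ q) s)
  (cong₂ _+_ (pair-scale a q s) (trans (lemma (s 0) (pair (p *ₚ q) (s ∘ suc))) (pair-* p q (s ∘ suc))))
  where
  lemma : ∀ x y → 0 * x + y ≡ y
  lemma = solve-∀ ℚ-ring

pair-C : ∀ a s → pair (C a) s ≡ a * s 0
pair-C a s = ℚ.+-identityʳ (a * s 0)

pair-C* : ∀ a p s → pair (C a *ₚ p) s ≡ a * pair p s
pair-C* a p s = trans (pair-* (C a) p s) (pair-C a (λ i → pair p (shift i s)))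

pair-X^ : ∀ n s → pair (X ^ₚ n) s ≡ s n
pair-X^ zero    s = trans (pair-C 1 s) (ℚ.*-identityˡ (s 0))
pair-X^ (suc n) s = trans (pair-* X (X ^ₚ n) s)
  (trans (lemma (pair (X ^ₚ n) s) (pair (X ^ₚ n) (s ∘ suc))) (pair-X^ n (s ∘ suc)))
  where
  lemma : ∀ x y → 0 * x + (1 * y + 0) ≡ y
  lemma = solve-∀ ℚ-ring

pair-binomial : ∀ n a s → pair (X ^ₚ n +ₚ C a) s ≡ s n + a * s 0
pair-binomial n a s = trans (pair-+ (X ^ₚ n) (C a) s) (cong₂ _+_ (pair-X^ n s) (pair-C a s))

pair-trinomial : ∀ n k A B s → pair (trinomial n k A B) s ≡ s n + A * s k + B * s 0
pair-trinomial n k A B s = trans (pair-+ (X ^ₚ n +ₚ C A *ₚ X ^ₚ k) (C B) s) (cong₂ _+_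
  (trans (pair-+ (X ^ₚ n) (C A *ₚ X ^ₚ k) s) (cong₂ _+_ (pair-X^ n s)
    (trans (pair-C* A (X ^ₚ k) s) (cong (A *_) (pair-X^ k s)))))
  (pair-C B s))

eval-pair : ∀ p x → eval p x ≡ pair p (x ^_)
eval-pair []      x = refl
eval-pair (a ∷ p) x = cong₂ _+_ (sym (ℚ.*-identityʳ a))
  (trans (cong (x *_) (eval-pair p x)) (sym (geometric p (x ^_))))
  where
  geometric : ∀ p s → pair p (λ n → x * s n) ≡ x * pair p s
  geometric []      s = sym (ℚ.*-zeroʳ x)
  geometric (b ∷ p) s = trans (cong (b * (x * s 0) +_) (geometric p (s ∘ suc)))
    (lemma b x (s 0) (pair p (s ∘ suc)))
    where
    lemma : ∀ b x y z → b * (x * y) + x * z ≡ x * (b * y + z)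
    lemma = solve-∀ ℚ-ring

δ : ℕ → Sequence
δ zero    zero    = 1
δ zero    (suc m) = 0
δ (suc n) zero    = 0
δ (suc n) (suc m) = δ n m

coeff-pair : ∀ p n → coeff p n ≡ pair p (δ n)
coeff-pair []      n       = refl
coeff-pair (a ∷ p) zero    = sym (trans (cong₂ _+_ (ℚ.*-identityʳ a) (pair-zero p)) (ℚ.+-identityʳ a))
coeff-pair (a ∷ p) (suc n) = trans (coeff-pair p n)
  (sym (trans (cong (_+ pair p (δ n)) (ℚ.*-zeroʳ a)) (ℚ.+-identityˡ (pair p (δ n)))))

pair⇒≈ : ∀ p q → (∀ s → pair p s ≡ pair q s) → p ≈ q
pair⇒≈ p q eq n = trans (coeff-pair p n) (trans (eq (δ n)) (sym (coeff-pair q n)))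

-- Factorisation of the family.

pair-two-binomials* : ∀ m n a b h s → pair ((X ^ₚ m +ₚ C a) *ₚ (X ^ₚ n +ₚ C b) *ₚ h) s ≡
  (pair h (shift n (shift m s)) + b * pair h (shift m s)) + a * (pair h (shift n s) + b * pair h s)
pair-two-binomials* m n a b h s = begin
  pair (p *ₚ q *ₚ h) s                               ≡⟨ pair-* (p *ₚ q) h s ⟩
  pair (p *ₚ q) t                                    ≡⟨ pair-* p q t ⟩
  pair p (λ j → pair q (shift j t))                  ≡⟨ pair-binomial m a (λ j → pair q (shift j t)) ⟩
  pair q (shift m t) + a * pair q t
    ≡⟨ cong₂ (λ y z → y + a * z) (pair-binomial n b (shift m t)) (pair-binomial n b t) ⟩
  (shift m t n + b * shift m t 0) + a * (t n + b * t 0)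
    ≡⟨ cong₂ (λ y z → (y + b * z) + a * (t n + b * t 0)) (shift-pair m n s) (shift-pair m 0 s) ⟩
  (pair h (shift n (shift m s)) + b * pair h (shift m s)) + a * (t n + b * t 0) ∎
  where
  open ≡-Reasoning
  p = X ^ₚ m +ₚ C a
  q = X ^ₚ n +ₚ C b
  t : Sequence
  t i = pair h (shift i s)
  shift-pair : ∀ m n s → shift m (λ i → pair h (shift i s)) n ≡ pair h (shift n (shift m s))
  shift-pair zero    n s = refl
  shift-pair (suc m) n s = shift-pair m n (s ∘ suc)

-- The coefficients involve the variables r and w. Pairing with an arbitrary sequence reduces the
-- equality to a single ring identity, linear in s 0, s 3, s 6, s 9 and s 12.
factorisation : ∀ r w →
  trinomial 12 3 (- (r - w) * (r ^ 2 + w ^ 2)) (- r * w * (r ^ 2 - r * w + w ^ 2))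
    ≈ (X ^ₚ 3 -ₚ C r) *ₚ (X ^ₚ 3 +ₚ C w)
      *ₚ (X ^ₚ 6 +ₚ C (r - w) *ₚ X ^ₚ 3 +ₚ C (r ^ 2 - r * w + w ^ 2))
factorisation r w = pair⇒≈ (trinomial 12 3 A B)
  ((X ^ₚ 3 -ₚ C r) *ₚ (X ^ₚ 3 +ₚ C w) *ₚ trinomial 6 3 u v) λ s → begin
  pair (trinomial 12 3 A B) s                        ≡⟨ pair-trinomial 12 3 A B s ⟩
  s 12 + A * s 3 + B * s 0                           ≡⟨ lemma r w (s 0) (s 3) (s 6) (s 9) (s 12) ⟩
  (s 12 + u * s 9 + v * s 6 + w * (s 9 + u * s 6 + v * s 3))
    + - r * (s 9 + u * s 6 + v * s 3 + w * (s 6 + u * s 3 + v * s 0))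
      ≡⟨ cong₂ (λ y z → y + - r * z)
           (cong₂ (λ y z → y + w * z) (pair-trinomial 6 3 u v (shift 6 s))
             (pair-trinomial 6 3 u v (shift 3 s)))
           (cong₂ (λ y z → y + w * z) (pair-trinomial 6 3 u v (shift 3 s)) (pair-trinomial 6 3 u v s)) ⟨
  (pair h (shift 6 s) + w * pair h (shift 3 s)) + - r * (pair h (shift 3 s) + w * pair h s)
      ≡⟨ pair-two-binomials* 3 3 (- r) w h s ⟨
  pair ((X ^ₚ 3 -ₚ C r) *ₚ (X ^ₚ 3 +ₚ C w) *ₚ h) s   ∎
  where
  open ≡-Reasoning
  A = - (r - w) * (r ^ 2 + w ^ 2)
  B = - r * w * (r ^ 2 - r * w + w ^ 2)
  u = r - w
  v = r ^ 2 - r * w + w ^ 2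
  h = trinomial 6 3 u v
  -- Powers are spelled out in the form to which `_^_` unfolds.
  lemma : ∀ r w s₀ s₃ s₆ s₉ s₁₂ →
    s₁₂ + - (r - w) * (r * (r * 1) + w * (w * 1)) * s₃ +
      - r * w * (r * (r * 1) - r * w + w * (w * 1)) * s₀ ≡
    (s₁₂ + (r - w) * s₉ + (r * (r * 1) - r * w + w * (w * 1)) * s₆
      + w * (s₉ + (r - w) * s₆ + (r * (r * 1) - r * w + w * (w * 1)) * s₃))
    + - r * (s₉ + (r - w) * s₆ + (r * (r * 1) - r * w + w * (w * 1)) * s₃
      + w * (s₆ + (r - w) * s₃ + (r * (r * 1) - r * w + w * (w * 1)) * s₀))
  lemma = solve-∀ ℚ-ring

-- The quotient by x³ - r and its cubic factor in dual form.

root⇒B : ∀ {A B r} → IsRoot (trinomial 4 1 A B) r → B ≡ - r * (r * r * r + A)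
root⇒B {A} {B} {r} root = ℚ-from-eq B (- r * (r * r * r + A)) 1
  (trans (sym (trans (eval-pair (trinomial 4 1 A B) r) (pair-trinomial 4 1 A B (r ^_)))) root)
    (lemma A B r)
  where
  lemma : ∀ A B r → B - - r * (r * r * r + A) ≡ 1 * (r * (r * (r * (r * 1))) + A * (r * 1) + B * 1 - 0)
  lemma = solve-∀ ℚ-ring

-- Solves s (3 + n) − r s n = t n from given initial values.
lift : ℚ → Sequence → ℚ → ℚ → ℚ → Sequence
lift r t x y z zero    = x
lift r t x y z (suc n) = lift r (t ∘ suc) y z (t 0 + r * x) n

pair-lift : ∀ r t x y z i → pair (X ^ₚ 3 -ₚ C r) (shift i (lift r t x y z)) ≡ t i
pair-lift r t x y z zero    = trans (pair-binomial 3 (- r) (lift r t x y z)) (lemma r x (t 0))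
  where
  lemma : ∀ r x t → t + r * x + - r * x ≡ t
  lemma = solve-∀ ℚ-ring
pair-lift r t x y z (suc i) = pair-lift r (t ∘ suc) y z (t 0 + r * x) i

-- Every sequence t arises from some s as s (3 + n) - r s n, that is, by the adjoint of
-- multiplication by x³ - r. The value of Q at t is then that of the trinomial at s.
pair-quotient : ∀ {A B r Q} → Q *ₚ (X ^ₚ 3 -ₚ C r) ≈ trinomial 12 3 A B → ∀ t →
  pair Q t ≡ t 9 + r * t 6 + r * r * t 3 + (r * r * r + A) * t 0
pair-quotient {A} {B} {r} {Q} eq t = begin
  pair Q t
    ≡⟨ pair-cong Q (λ i → sym (pair-lift r t 0 0 0 i)) ⟩
  pair Q (λ i → pair (X ^ₚ 3 -ₚ C r) (shift i s))            ≡⟨ pair-* Q (X ^ₚ 3 -ₚ C r) s ⟨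
  pair (Q *ₚ (X ^ₚ 3 -ₚ C r)) s
    ≡⟨ pair-≈ (Q *ₚ (X ^ₚ 3 -ₚ C r)) (trinomial 12 3 A B) eq s ⟩
  pair (trinomial 12 3 A B) s                                ≡⟨ pair-trinomial 12 3 A B s ⟩
  s 12 + A * s 3 + B * s 0                                   ≡⟨ lemma A B r (t 0) (t 3) (t 6) (t 9) ⟩
  t 9 + r * t 6 + r * r * t 3 + (r * r * r + A) * t 0        ∎
  where
  open ≡-Reasoning
  -- Zero initial values make the term with B vanish.
  s = lift r t 0 0 0
  lemma : ∀ A B r t₀ t₃ t₆ t₉ →
    t₉ + r * (t₆ + r * (t₃ + r * (t₀ + r * 0))) + A * (t₀ + r * 0) + B * 0
    ≡ t₉ + r * t₆ + r * r * t₃ + (r * r * r + A) * t₀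
  lemma = solve-∀ ℚ-ring

-- With varying x, y, z these sequences form the dual of ℚ[x]/(f) for f = x³ + ax² + bx + d; the
-- initial values are the values at 1, x and x².
recurrence : (a b d x y z : ℚ) → Sequence
recurrence a b d x y z zero    = x
recurrence a b d x y z (suc n) = recurrence a b d y z (- (a * z + b * y + d * x)) n

cubic : (e a b d : ℚ) → Poly
cubic e a b d = e * d ∷ e * b ∷ e * a ∷ e ∷ []

pair-cubic : ∀ e a b d x y z i → pair (cubic e a b d) (shift i (recurrence a b d x y z)) ≡ 0
pair-cubic e a b d x y z zero    = lemma e a b d x y z
  where
  lemma : ∀ e a b d x y z →
    e * d * x + (e * b * y + (e * a * z + (e * - (a * z + b * y + d * x) + 0))) ≡ 0
  lemma = solve-∀ ℚ-ring
pair-cubic e a b d x y z (suc i) = pair-cubic e a b d y z (- (a * z + b * y + d * x)) i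

degree-3⇒cubic : ∀ {f} → HasDegree f 3 → ∃[ e ] ∃[ a ] ∃[ b ] ∃[ d ] f ≈ cubic e a b d
degree-3⇒cubic {f} (f₃≢0 , f≥4≡0) = from-inverse (ℚ-inverse f₃≢0)
  where
  from-inverse : (∃[ y ] coeff f 3 * y ≡ 1) → ∃[ e ] ∃[ a ] ∃[ b ] ∃[ d ] f ≈ cubic e a b d
  from-inverse (y , ey≡1) = e , coeff f 2 * y , coeff f 1 * y , coeff f 0 * y , λ
    { 0 → normalise (coeff f 0) ; 1 → normalise (coeff f 1) ; 2 → normalise (coeff f 2) ; 3 → refl
    ; (suc (suc (suc (suc n)))) → f≥4≡0 (suc (suc (suc (suc n)))) (s≤s (s≤s (s≤s (s≤s z≤n)))) }
    where
    e = coeff f 3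
    normalise : ∀ x → x ≡ e * (x * y)
    normalise x = ℚ-from-eq x (e * (x * y)) (- x) ey≡1 (lemma e x y)
      where
      lemma : ∀ e x y → x - e * (x * y) ≡ - x * (e * y - 1)
      lemma = solve-∀ ℚ-ring

pair-multiple : ∀ {e a b d f Q} → f ≈ cubic e a b d → f ∣ Q → ∀ x y z →
  pair Q (recurrence a b d x y z) ≡ 0
pair-multiple {e} {a} {b} {d} {f} {Q} f≈ f∣Q x y z = begin
  pair Q s                              ≡⟨ pair-≈ (h *ₚ f) Q hf≈Q s ⟨
  pair (h *ₚ f) s                       ≡⟨ pair-* h f s ⟩
  pair h (λ i → pair f (shift i s))
    ≡⟨ pair-cong h (λ i → trans (pair-≈ f (cubic e a b d) f≈ (shift i s))
    (pair-cubic e a b d x y z i)) ⟩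
  pair h (λ _ → 0)                      ≡⟨ pair-zero h ⟩
  0                                     ∎
  where
  open ≡-Reasoning
  open _∣ʳ_ f∣Q renaming (quotient to h; equality to hf≈Q)
  s = recurrence a b d x y z

-- Comparison of g with χ.

-- x³ + ax² + bx + d divides x⁹ + rx⁶ + r²x³ + c, in dual form.
Annihilated : (a b d r c : ℚ) → Set
Annihilated a b d r c = ∀ x y z →
  let s = recurrence a b d x y z in s 9 + r * s 6 + r * r * s 3 + c * s 0 ≡ 0

-- χ(x³) = f(x) f(ωx) f(ω²x) for f = x³ + ax² + bx + d, and x⁶ ≡ p₂x² + p₁x + p₀ modulo f.
module Relation (a b d r c : ℚ) (vanish : Annihilated a b d r c) where

  χ₂ = a * a * a - 3 * a * b + 3 * d
  χ₁ = b * b * b - 3 * a * b * d + 3 * d * d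
  χ₀ = d * d * d
  -- The quotient of x⁶ by f is x³ - ax² + (a² - b)x + w.
  w  = 2 * a * b - d - a * a * a
  p₂ = a * d - a * a * b + b * b - w * a
  p₁ = - (a * a - b) * d - w * b
  p₀ = - w * d

  -- The multipliers are the coefficients of f(ωx) f(ω²x), corrected by those of
  -- the quotient of (r − χ₂)x⁶ + (r² − χ₁)x³ by f.
  relation : ∀ x y z → (r - χ₂) * (p₂ * z + p₁ * y + p₀ * x) + (r * r - χ₁) *
    - (a * z + b * y + d * x) + (c - χ₀) * x ≡ 0
  relation x y z = trans (identity a b d r c (s 0) (s 1) (s 2) (s 3) (s 4) (s 5) (s 6) (s 7) (s 8)
    (s 9))
    (cong₂ _-_ (vanish x y z) (sum-zero (sum-zero (sum-zero (sum-zero (sum-zero (sum-zero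
      (vanishes 6 1) (vanishes 5 (- a))) (vanishes 4 (a * a - b)))
        (vanishes 3 (2 * d - a * b + (r - χ₂)))) (vanishes 2 (b * b - a * d + ((r - χ₂) * - a))))
        (vanishes 1 (- (b * d) + ((r - χ₂) * (a * a - b)))))
        (vanishes 0 (d * d + ((r - χ₂) * w + (r * r - χ₁))))))
    where
    s = recurrence a b d x y z
    sum-zero : ∀ {x y} → x ≡ 0 → y ≡ 0 → x + y ≡ 0
    sum-zero refl refl = refl
    step-zero : ∀ x y z → - (a * z + b * y + d * x) + a * z + b * y + d * x ≡ 0
    step-zero = lemma a b d
      where
      lemma : ∀ a b d x y z → - (a * z + b * y + d * x) + a * z + b * y + d * x ≡ 0
      lemma = solve-∀ ℚ-ring
    vanishes : ∀ i u → u * (s (3 ℕ.+ i) + a * s (2 ℕ.+ i) + b * s (1 ℕ.+ i) + d * s i) ≡ 0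
    vanishes i u = trans (cong (u *_) (steps i x y z)) (ℚ.*-zeroʳ u)
      where
      steps : ∀ i x y z → let s = recurrence a b d x y z in s (3 ℕ.+ i) + a * s (2 ℕ.+ i)
        + b * s (1 ℕ.+ i) + d * s i ≡ 0
      steps zero    x y z = step-zero x y z
      steps (suc i) x y z = steps i y z (- (a * z + b * y + d * x))
    identity : ∀ a b d r c s0 s1 s2 s3 s4 s5 s6 s7 s8 s9 →
      (r - (a * a * a - 3 * a * b + 3 * d)) *
        ((a * d - a * a * b + b * b - (2 * a * b - d - a * a * a) * a) * s2
        + (- (a * a - b) * d - (2 * a * b - d - a * a * a) * b) * s1
        + (- (2 * a * b - d - a * a * a) * d) * s0)
        + (r * r - (b * b * b - 3 * a * b * d + 3 * d * d)) * - (a * s2 + b * s1 + d * s0)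
        + (c - d * d * d) * s0
      ≡ s9 + r * s6 + r * r * s3 + c * s0
        - (1 * (s9 + a * s8 + b * s7 + d * s6)
          + (- a) * (s8 + a * s7 + b * s6 + d * s5)
          + (a * a - b) * (s7 + a * s6 + b * s5 + d * s4)
          + (2 * d - a * b + ((r - (a * a * a - 3 * a * b + 3 * d)))) * (s6 + a * s5 + b * s4 + d * s3)
          + (b * b - a * d + ((r - (a * a * a - 3 * a * b + 3 * d)) * - a)) * (s5 + a * s4 + b * s3
            + d * s2)
          + (- (b * d) + ((r - (a * a * a - 3 * a * b + 3 * d)) * (a * a - b))) * (s4 + a * s3
            + b * s2 + d * s1)
          + (d * d + ((r - (a * a * a - 3 * a * b + 3 * d)) * (2 * a * b - d - a * a * a)
            + (r * r - (b * b * b - 3 * a * b * d + 3 * d * d)))) * (s3 + a * s2 + b * s1 + d * s0))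
    identity = solve-∀ ℚ-ring

  -- Evaluation at a root t of f is one of the functionals covered by `Annihilated`, which therefore
  -- yields g(t³) = 0.
  geometric : ∀ t → t * t * t + a * t * t + b * t + d ≡ 0 → ∀ n x →
    recurrence a b d x (t * x) (t * (t * x)) n ≡ t ^ n * x
  geometric t root zero    x = sym (ℚ.*-identityˡ x)
  geometric t root (suc n) x = trans
    (cong (λ z → recurrence a b d (t * x) (t * (t * x)) z n)
      (ℚ-from-eq _ (t * (t * (t * x))) (- x) root (lemma a b d t x)))
    (trans (geometric t root n (t * x)) (rearrange t (t ^ n) x))
    where
    lemma : ∀ a b d t x → - (a * (t * (t * x)) + b * (t * x) + d * x) - t * (t * (t * x))
      ≡ - x * (t * t * t + a * t * t + b * t + d - 0)
    lemma = solve-∀ ℚ-ring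
    rearrange : ∀ t u x → u * (t * x) ≡ t * u * x
    rearrange = solve-∀ ℚ-ring

  -- The equation says g(-w) = 0; the sign matches the factor x³ + w of the family.
  RationalRoot : Set
  RationalRoot = ∃[ w ] c ≡ w * (w * w - r * w + r * r)

  -- This is the determinant `a * p₁ - b * p₂` of the x²- and x-coordinates of x³ and x⁶ modulo f.
  -- In terms of the roots of f it is the product of xᵢ² + xᵢxⱼ + xⱼ² over the pairs i < j.
  Δ = a * a * (b * b) - b * b * b - a * a * a * d

  -- Cramer's rule for the x²- and x-coordinates of g(x³) - χ(x³) modulo f; the constant coordinate
  -- then gives c.
  Δ≢0⇒g≡χ : Δ ≢ 0 → r ≡ χ₂ × r * r ≡ χ₁ × c ≡ χ₀
  Δ≢0⇒g≡χ Δ≢0 = zero⇒≡ r χ₂ r-χ₂≡0 , zero⇒≡ (r * r) χ₁ r²-χ₁≡0 , zero⇒≡ c χ₀ c-χ₀≡0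
    where
    zero⇒≡ : ∀ x y → x - y ≡ 0 → x ≡ y
    zero⇒≡ x y eq = ℚ-from-eq x y 1 eq (lemma x y)
      where
      lemma : ∀ x y → x - y ≡ 1 * (x - y - 0)
      lemma = solve-∀ ℚ-ring
    r-χ₂≡0 : r - χ₂ ≡ 0
    r-χ₂≡0 = ℚ-cancel Δ≢0 (ℚ-from-eqs (Δ * (r - χ₂)) 0 (- b) a (relation 0 0 1) (relation 0 1 0)
      (lemma a b d (r - χ₂) (r * r - χ₁) (c - χ₀)))
      where
      lemma : ∀ a b d u v z → (a * a * (b * b) - b * b * b - a * a * a * d) * u - 0 ≡
        - b * (u * ((a * d - a * a * b + b * b - (2 * a * b - d - a * a * a) * a) * 1
                  + (- (a * a - b) * d - (2 * a * b - d - a * a * a) * b) * 0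
                  + - (2 * a * b - d - a * a * a) * d * 0) + v * - (a * 1 + b * 0 + d * 0) + z * 0 - 0)
        + a * (u * ((a * d - a * a * b + b * b - (2 * a * b - d - a * a * a) * a) * 0
                  + (- (a * a - b) * d - (2 * a * b - d - a * a * a) * b) * 1
                  + - (2 * a * b - d - a * a * a) * d * 0) + v * - (a * 0 + b * 1 + d * 0) + z * 0 - 0)
      lemma = solve-∀ ℚ-ring
    r²-χ₁≡0 : r * r - χ₁ ≡ 0
    r²-χ₁≡0 = ℚ-cancel Δ≢0 (ℚ-from-eqs (Δ * (r * r - χ₁)) 0 (- p₁) p₂ (relation 0 0 1)
      (relation 0 1 0) (lemma a b d (r - χ₂) (r * r - χ₁) (c - χ₀)))
      where
      lemma : ∀ a b d u v z → (a * a * (b * b) - b * b * b - a * a * a * d) * v - 0 ≡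
        - (- (a * a - b) * d - (2 * a * b - d - a * a * a) * b) *
          (u * ((a * d - a * a * b + b * b - (2 * a * b - d - a * a * a) * a) * 1
                  + (- (a * a - b) * d - (2 * a * b - d - a * a * a) * b) * 0
                  + - (2 * a * b - d - a * a * a) * d * 0) + v * - (a * 1 + b * 0 + d * 0) + z * 0 - 0)
        + (a * d - a * a * b + b * b
          - (2 * a * b - d - a * a * a) * a) *
          (u * ((a * d - a * a * b + b * b - (2 * a * b - d - a * a * a) * a) * 0
                  + (- (a * a - b) * d - (2 * a * b - d - a * a * a) * b) * 1
                  + - (2 * a * b - d - a * a * a) * d * 0) + v * - (a * 0 + b * 1 + d * 0) + z * 0 - 0)
      lemma = solve-∀ ℚ-ring
    c-χ₀≡0 : c - χ₀ ≡ 0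
    c-χ₀≡0 = trans (lemma (p₂ * 0 + p₁ * 0 + p₀ * 1) (- (a * 0 + b * 0 + d * 1)) (c - χ₀))
      (subst₂ (λ u v → u * (p₂ * 0 + p₁ * 0 + p₀ * 1) + v * - (a * 0 + b * 0 + d * 1) + (c - χ₀) * 1
        ≡ 0) r-χ₂≡0 r²-χ₁≡0 (relation 1 0 0))
      where
      lemma : ∀ x y z → z ≡ 0 * x + 0 * y + z * 1
      lemma = solve-∀ ℚ-ring

  -- If Δ = 0, the ratio of two roots of f is a nontrivial cube root of unity, and
  -- the third root is b/a − a.
  Δ≡0⇒root : Δ ≡ 0 → a ≢ 0 → RationalRoot
  Δ≡0⇒root Δ≡0 a≢0 = from-inverse (ℚ-inverse a≢0)
    where
    from-root : ∀ t → t * t * t + a * t * t + b * t + d ≡ 0 → RationalRoot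
    from-root t f[t]≡0 = - (t * t * t) , ℚ-from-eq c _ 1 g≡0 (lemma r c t)
      where
      powers : ∀ n → recurrence a b d 1 (t * 1) (t * (t * 1)) n ≡ t ^ n * 1
      powers n = geometric t f[t]≡0 n 1
      g≡0 : t ^ 9 * 1 + r * (t ^ 6 * 1) + r * r * (t ^ 3 * 1) + c * 1 ≡ 0
      g≡0 = trans (sym (cong₂ (λ x y →
        x + c * y) (cong₂ (λ x y → x + r * r * y) (cong₂ (λ x y → x + r * y)
        (powers 9) (powers 6)) (powers 3)) refl)) (vanish 1 (t * 1) (t * (t * 1)))
      lemma : ∀ r c t → c - - (t * t * t) * (- (t * t * t) * - (t * t * t) - r * - (t * t * t) + r * r)
        ≡ 1 * (t * (t * (t * (t * (t * (t * (t * (t * (t * 1)))))))) * 1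
          + r * (t * (t * (t * (t * (t * (t * 1))))) * 1)
          + r * r * (t * (t * (t * 1)) * 1) + c * 1 - 0)
      lemma = solve-∀ ℚ-ring
    from-inverse : (∃[ y ] a * y ≡ 1) → RationalRoot
    from-inverse (y , ay≡1) = from-root (b * y - a) (ℚ-from-eqs _ 0 (- (y * y * y))
        (b * b * y * (a * y - 1) + a * b - d * (1 + a * y + a * a * y * y)) Δ≡0 ay≡1 (lemma a b d y))
      where
      lemma : ∀ a b d y →
        (b * y - a) * (b * y - a) * (b * y - a) + a * (b * y - a) * (b * y - a) + b * (b * y - a) + d
          - 0
        ≡ - (y * y * y) * (a * a * (b * b) - b * b * b - a * a * a * d - 0)
          + (b * b * y * (a * y - 1) + a * b - d * (1 + a * y + a * a * y * y)) * (a * y - 1)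
      lemma = solve-∀ ℚ-ring

  cube≡0 : ∀ x → x * x * x ≡ 0 → x ≡ 0
  cube≡0 x x³≡0 = [ (λ x²≡0 → [ (λ x≡0 → x≡0) , (λ x≡0 → x≡0) ]′ (ℚ-zero-product x x x²≡0))
    , (λ x≡0 → x≡0) ]′ (ℚ-zero-product (x * x) x x³≡0)

  -- For a = 0 one has Δ = -b³, so f = x³ + d, and x³ is the rational number -d modulo f.
  Δ≡0⇒binomial : Δ ≡ 0 → a ≡ 0 → RationalRoot
  Δ≡0⇒binomial Δ≡0 a≡0 = d , ℚ-from-eq c (d * (d * d - r * d + r * r)) 1
    (subst₂ (λ a b → (r - (a * a * a - 3 * a * b + 3 * d)) *
      ((a * d - a * a * b + b * b - (2 * a * b - d - a * a * a) * a) * 0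
      + (- (a * a - b) * d - (2 * a * b - d - a * a * a) * b) * 0 +
      - (2 * a * b - d - a * a * a) * d * 1)
        + (r * r - (b * b * b - 3 * a * b * d + 3 * d * d)) * - (a * 0 + b * 0 + d * 1)
          + (c - d * d * d) * 1 ≡ 0) a≡0 b≡0 (relation 1 0 0))
    (lemma d r c)
    where
    b≡0 : b ≡ 0
    b≡0 = cube≡0 b (ℚ-from-eq (b * b * b) 0 (- 1)
      (subst (λ a → a * a * (b * b) - b * b * b - a * a * a * d ≡ 0) a≡0 Δ≡0) (rearrange b d))
      where
      rearrange : ∀ b d → b * b * b - 0 ≡ - 1 * (0 * 0 * (b * b) - b * b * b - 0 * 0 * 0 * d - 0)
      rearrange = solve-∀ ℚ-ring
    lemma : ∀ d r c → c - d * (d * d - r * d + r * r) ≡ 1 *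
      ((r - (0 * 0 * 0 - 3 * 0 * 0 + 3 * d)) *
        ((0 * d - 0 * 0 * 0 + 0 * 0 - (2 * 0 * 0 - d - 0 * 0 * 0) * 0) * 0
          + (- (0 * 0 - 0) * d - (2 * 0 * 0 - d - 0 * 0 * 0) * 0) * 0 +
            - (2 * 0 * 0 - d - 0 * 0 * 0) * d * 1)
        + (r * r - (0 * 0 * 0 - 3 * 0 * 0 * d + 3 * d * d)) * - (0 * 0 + 0 * 0 + d * 1)
          + (c - d * d * d) * 1 - 0)
    lemma = solve-∀ ℚ-ring

  root-or-g≡χ : RationalRoot ⊎ (r ≡ χ₂ × r * r ≡ χ₁ × c ≡ χ₀)
  root-or-g≡χ with Δ ≟ 0
  ... | no  Δ≢0 = inj₂ (Δ≢0⇒g≡χ Δ≢0)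
  ... | yes Δ≡0 with a ≟ 0
  ...   | yes a≡0 = inj₁ (Δ≡0⇒binomial Δ≡0 a≡0)
  ...   | no  a≢0 = inj₁ (Δ≡0⇒root Δ≡0 a≢0)

-- The curve of genus one.

module _ (a b d : ℚ) where
  private
    r = a * a * a - 3 * a * b + 3 * d
    F = d - 2 * a * b + a * a * a
    G = 2 * d - a * b
    H = b - a * a

  -- χ₂² = χ₁ is the curve 3FG = H³, where G − 2F = a³ + 3aH.
  curve : r * r ≡ b * b * b - 3 * a * b * d + 3 * d * d → 3 * F * G ≡ H * H * H
  curve eq = ℚ-from-eq _ _ 1 eq (lemma a b d)
    where
    lemma : ∀ a b d → 3 * (d - 2 * a * b + a * a * a) * (2 * d - a * b)
      - (b - a * a) * (b - a * a) * (b - a * a)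
      ≡ 1 * ((a * a * a - 3 * a * b + 3 * d) * (a * a * a - 3 * a * b + 3 * d)
        - (b * b * b - 3 * a * b * d + 3 * d * d))
    lemma = solve-∀ ℚ-ring

  -- The numbers G, -2F and -a³ have sum 3aH and, on the curve, product 2(aH)³/3. Scaled by 18 they
  -- solve the homogeneous system with k = 6aH.
  curve⇒aH≡0 : 3 * F * G ≡ H * H * H → a * H ≡ 0
  curve⇒aH≡0 eq = ℚ-cancel {6} (λ ())
    (rational-solution⇒k≡0 (18 * G) (- 36 * F) (- 18 * (a * a * a)) (6 * (a * H))
    (sum a b d) (ℚ-from-eq _ _ (3888 * (a * a * a)) eq (prod a b d)))
    where
    sum : ∀ a b d → 18 * (2 * d - a * b) + - 36 * (d - 2 * a * b + a * a * a) + - 18 * (a * a * a)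
      ≡ 9 * (6 * (a * (b - a * a)))
    sum = solve-∀ ℚ-ring
    prod : ∀ a b d → 18 * (2 * d - a * b) * (- 36 * (d - 2 * a * b + a * a * a)) * (- 18 * (a * a * a))
        - 18 * (6 * (a * (b - a * a)) * (6 * (a * (b - a * a))) * (6 * (a * (b - a * a))))
      ≡ 3888 * (a * a * a) * (3 * (d - 2 * a * b + a * a * a) * (2 * d - a * b)
        - (b - a * a) * (b - a * a) * (b - a * a))
    prod = solve-∀ ℚ-ring

-- The family and the sporadic trinomials in terms of A and B.

module _ {A B r c : ℚ} (A≢0 : A ≢ 0) (B≢0 : B ≢ 0) (c≡ : r * r * r + A ≡ c) (B≡ : B ≡ - r * c) where

  private
    r≢0 : r ≢ 0
    r≢0 refl = B≢0 (trans B≡ (lemma c))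
      where
      lemma : ∀ c → - 0 * c ≡ 0
      lemma = solve-∀ ℚ-ring
    c≢0 : c ≢ 0
    c≢0 refl = B≢0 (trans B≡ (ℚ.*-zeroʳ (- r)))
    A≡ : A ≡ c - r * r * r
    A≡ = ℚ-from-eq A _ 1 c≡ (lemma A r c)
      where
      lemma : ∀ A r c → A - (c - r * r * r) ≡ 1 * (r * r * r + A - c)
      lemma = solve-∀ ℚ-ring

  family : ∀ w → c ≡ w * (w * w - r * w + r * r) →
      r * w * (r - w) ≢ 0
    × A ≡ - (r - w) * (r ^ 2 + w ^ 2)
    × B ≡ - r * w * (r ^ 2 - r * w + w ^ 2)
    × trinomial 12 3 A B
        ≈ (X ^ₚ 3 -ₚ C r) *ₚ (X ^ₚ 3 +ₚ C w)
          *ₚ (X ^ₚ 6 +ₚ C (r - w) *ₚ X ^ₚ 3 +ₚ C (r ^ 2 - r * w + w ^ 2))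
  family w c≡w = *≢0 (*≢0 r≢0 w≢0) r≢w , A≡w , B≡w ,
    subst₂ (λ A B → trinomial 12 3 A B ≈ (X ^ₚ 3 -ₚ C r) *ₚ (X ^ₚ 3 +ₚ C w)
        *ₚ (X ^ₚ 6 +ₚ C (r - w) *ₚ X ^ₚ 3 +ₚ C (r ^ 2 - r * w + w ^ 2)))
      (sym A≡w) (sym B≡w) (factorisation r w)
    where
    A≡w : A ≡ - (r - w) * (r ^ 2 + w ^ 2)
    A≡w = trans A≡ (ℚ-from-eq _ _ 1 c≡w (lemma c r w))
      where
      lemma : ∀ c r w → c - r * r * r - - (r - w) * (r * (r * 1) + w * (w * 1))
        ≡ 1 * (c - w * (w * w - r * w + r * r))
      lemma = solve-∀ ℚ-ring
    B≡w : B ≡ - r * w * (r ^ 2 - r * w + w ^ 2)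
    B≡w = trans B≡ (ℚ-from-eq _ _ (- r) c≡w (lemma c r w))
      where
      lemma : ∀ c r w → - r * c - - r * w * (r * (r * 1) - r * w + w * (w * 1))
        ≡ - r * (c - w * (w * w - r * w + r * r))
      lemma = solve-∀ ℚ-ring
    w≢0 : w ≢ 0
    w≢0 refl = c≢0 (trans c≡w (ℚ.*-zeroˡ (0 * 0 - r * 0 + r * r)))
    r≢w : r - w ≢ 0
    r≢w r-w≡0 = A≢0 (trans A≡w
      (trans (cong (λ x → - x * (r ^ 2 + w ^ 2)) r-w≡0) (lemma (r ^ 2 + w ^ 2))))
      where
      lemma : ∀ x → - 0 * x ≡ 0
      lemma = solve-∀ ℚ-ring

  module _ {a b d : ℚ} (r≡ : r ≡ a * a * a - 3 * a * b + 3 * d) (c≡d³ : c ≡ d * d * d) where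

    private
      d≢0 : d ≢ 0
      d≢0 refl = c≢0 c≡d³

    -- The curve becomes the cusp 6d² = b³, parametrised by t = d/b as b = 6t², d = 6t³. Thus f is a
    -- scaling of x³ + 6x + 6.
    a≡0⇒scaled : a ≡ 0 → 3 * (d - 2 * a * b + a * a * a) * (2 * d - a * b)
      ≡ (b - a * a) * (b - a * a) * (b - a * a) →
      UpToScaling A B (- 5616) (- 3888)
    a≡0⇒scaled refl eq = from-inverse (ℚ-inverse b≢0)
      where
      6d²≡b³ : 6 * d * d ≡ b * b * b
      6d²≡b³ = ℚ-from-eq _ _ 1 eq (lemma b d)
        where
        lemma : ∀ b d → 6 * d * d - b * b * b
          ≡ 1 * (3 * (d - 2 * 0 * b + 0 * 0 * 0) * (2 * d - 0 * b)
          - (b - 0 * 0) * (b - 0 * 0) * (b - 0 * 0))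
        lemma = solve-∀ ℚ-ring
      b≢0 : b ≢ 0
      b≢0 refl = *≢0 {6 * d} {d} (*≢0 {6} {d} (λ ()) d≢0) d≢0 6d²≡b³
      from-inverse : (∃[ y ] b * y ≡ 1) → UpToScaling A B (- 5616) (- 3888)
      from-inverse (y , by≡1) = t , *≢0 d≢0 y≢0 , scale (sub-b) (sub-d)
        where
        t = d * y
        y≢0 : y ≢ 0
        y≢0 refl with trans (sym (ℚ.*-zeroʳ b)) by≡1
        ... | ()
        sub-b : b ≡ 6 * t * t
        sub-b = ℚ-from-eqs _ _ (- (y * y)) (- b * (b * y + 1)) 6d²≡b³ by≡1 (lemma b d y)
          where
          lemma : ∀ b d y → b - 6 * (d * y) * (d * y)
            ≡ - (y * y) * (6 * d * d - b * b * b) + - b * (b * y + 1) * (b * y - 1)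
          lemma = solve-∀ ℚ-ring
        sub-d : d ≡ 6 * t * t * t
        sub-d = ℚ-from-eqs _ _ (- (d * y * (y * y))) (- d * (b * b * y * y + b * y + 1)) 6d²≡b³ by≡1
          (lemma b d y)
          where
          lemma : ∀ b d y → d - 6 * (d * y) * (d * y) * (d * y)
            ≡ - (d * y * (y * y)) * (6 * d * d - b * b * b) +
            - d * (b * b * y * y + b * y + 1) * (b * y - 1)
          lemma = solve-∀ ℚ-ring
        scale : b ≡ 6 * t * t → d ≡ 6 * t * t * t → A ≡ - 5616 * t ^ 9 × B ≡ - 3888 * t ^ 12
        scale b≡ d≡ = trans A≡ (trans (cong₂ (λ c r → c - r * r * r) c≡t r≡t) (lemma-A t))
                    , trans B≡ (trans (cong₂ (λ c r → - r * c) c≡t r≡t) (lemma-B t))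
          where
          c≡t : c ≡ 6 * t * t * t * (6 * t * t * t) * (6 * t * t * t)
          c≡t = trans c≡d³ (cong (λ d → d * d * d) d≡)
          r≡t : r ≡ 0 * 0 * 0 - 3 * 0 * (6 * t * t) + 3 * (6 * t * t * t)
          r≡t = trans r≡ (cong₂ (λ b d → 0 * 0 * 0 - 3 * 0 * b + 3 * d) b≡ d≡)
          lemma-A : ∀ t → 6 * t * t * t * (6 * t * t * t) * (6 * t * t * t)
              - (0 * 0 * 0 - 3 * 0 * (6 * t * t) + 3 * (6 * t * t * t)) * (0 * 0 * 0
                - 3 * 0 * (6 * t * t) + 3 * (6 * t * t * t)) * (0 * 0 * 0 - 3 * 0 * (6 * t * t)
                + 3 * (6 * t * t * t))
            ≡ - 5616 * (t * (t * (t * (t * (t * (t * (t * (t * (t * 1)))))))))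
          lemma-A = solve-∀ ℚ-ring
          lemma-B : ∀ t → - (0 * 0 * 0 - 3 * 0 * (6 * t * t)
            + 3 * (6 * t * t * t)) * (6 * t * t * t * (6 * t * t * t) * (6 * t * t * t))
            ≡ - 3888 * (t * (t * (t * (t * (t * (t * (t * (t * (t * (t * (t * (t * 1))))))))))))
          lemma-B = solve-∀ ℚ-ring

    -- H = 0 leaves FG = 0. If F = 0, then d = a³ and r³ = c, contrary to A ≠ 0. If G = 0, then b =
    -- a² and d = a³/2, so with t = a/2 the polynomial f is a scaling of x³ + 2x² + 4x + 4.
    H≡0⇒scaled : a ≢ 0 → b - a * a ≡ 0 → 3 * (d - 2 * a * b + a * a * a) * (2 * d - a * b)
      ≡ (b - a * a) * (b - a * a) * (b - a * a) →
      UpToScaling A B 128 256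
    H≡0⇒scaled a≢0 H≡0 eq = t , *≢0 a≢0 (λ ()) , scale a≡ b≡ d≡
      where
      t = a * ½
      a≡ : a ≡ 2 * t
      a≡ = lemma a
        where
        lemma : ∀ a → a ≡ 2 * (a * ½)
        lemma = solve-∀ ℚ-ring
      b≡ : b ≡ 4 * t * t
      b≡ = ℚ-from-eq _ _ 1 H≡0 (lemma a b)
        where
        lemma : ∀ a b → b - 4 * (a * ½) * (a * ½) ≡ 1 * (b - a * a - 0)
        lemma = solve-∀ ℚ-ring
      F≢0 : d - 2 * a * b + a * a * a ≢ 0
      F≢0 F≡0 = A≢0 (trans A≡ (trans (cong₂ (λ c r → c - r * r * r) c≡d³ r≡) (degenerate a b d
          (ℚ-from-eq _ _ 1 H≡0 (lemma-b a b)) (ℚ-from-eqs _ _ 1 (2 * a) F≡0 H≡0 (lemma-d a b d)))))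
        where
        lemma-b : ∀ a b → b - a * a ≡ 1 * (b - a * a - 0)
        lemma-b = solve-∀ ℚ-ring
        lemma-d : ∀ a b d → d - a * a * a
          ≡ 1 * (d - 2 * a * b + a * a * a - 0) + 2 * a * (b - a * a - 0)
        lemma-d = solve-∀ ℚ-ring
        degenerate : ∀ a b d → b ≡ a * a → d ≡ a * a * a →
          d * d * d - (a * a * a - 3 * a * b + 3 * d) * (a * a * a - 3 * a * b + 3 * d) * (a * a * a
            - 3 * a * b + 3 * d) ≡ 0
        degenerate a _ _ refl refl = lemma a
          where
          lemma : ∀ a → a * a * a * (a * a * a) * (a * a * a)
            - (a * a * a - 3 * a * (a * a) + 3 * (a * a * a)) * (a * a * a - 3 * a * (a * a)
              + 3 * (a * a * a)) * (a * a * a - 3 * a * (a * a) + 3 * (a * a * a)) ≡ 0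
          lemma = solve-∀ ℚ-ring
      G≡0 : 2 * d - a * b ≡ 0
      G≡0 = ℚ-cancel (*≢0 {3} (λ ()) F≢0) (trans eq (trans (cong (λ h → h * h * h) H≡0) refl))
      d≡ : d ≡ 4 * t * t * t
      d≡ = ℚ-from-eqs _ _ ½ (½ * a) G≡0 H≡0 (lemma a b d)
        where
        lemma : ∀ a b d → d - 4 * (a * ½) * (a * ½) * (a * ½)
          ≡ ½ * (2 * d - a * b - 0) + ½ * a * (b - a * a - 0)
        lemma = solve-∀ ℚ-ring
      scale : a ≡ 2 * t → b ≡ 4 * t * t → d ≡ 4 * t * t * t → A ≡ 128 * t ^ 9 × B ≡ 256 * t ^ 12
      scale a≡ b≡ d≡ = trans A≡ (trans (cong₂ (λ c r → c - r * r * r) c≡t r≡t) (lemma-A t))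
                     , trans B≡ (trans (cong₂ (λ c r → - r * c) c≡t r≡t) (lemma-B t))
        where
        c≡t : c ≡ 4 * t * t * t * (4 * t * t * t) * (4 * t * t * t)
        c≡t = trans c≡d³ (cong (λ d → d * d * d) d≡)
        r≡t : r ≡ - 4 * t * t * t
        r≡t = trans r≡ (trans (cong₂ (λ x y →
          x + 3 * y) (cong₂ (λ a b → a * a * a - 3 * a * b) a≡ b≡) d≡) (lemma-r t))
          where
          lemma-r : ∀ t → 2 * t * (2 * t) * (2 * t) - 3 * (2 * t) * (4 * t * t) + 3 * (4 * t * t * t)
            ≡ - 4 * t * t * t
          lemma-r = solve-∀ ℚ-ring
        lemma-A : ∀ t → 4 * t * t * t * (4 * t * t * t) * (4 * t * t * t)
          - - 4 * t * t * t * (- 4 * t * t * t) * (- 4 * t * t * t)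
          ≡ 128 * (t * (t * (t * (t * (t * (t * (t * (t * (t * 1)))))))))
        lemma-A = solve-∀ ℚ-ring
        lemma-B : ∀ t → - (- 4 * t * t * t) * (4 * t * t * t * (4 * t * t * t) * (4 * t * t * t))
          ≡ 256 * (t * (t * (t * (t * (t * (t * (t * (t * (t * (t * (t * (t * 1))))))))))))
        lemma-B = solve-∀ ℚ-ring

  trichotomy : ∀ {Q} → Q *ₚ (X ^ₚ 3 -ₚ C r) ≈ trinomial 12 3 A B → HasFactorOfDegree Q 3 →
    (∃[ w ] c ≡ w * (w * w - r * w + r * r)) ⊎ UpToScaling A B 128 256
      ⊎ UpToScaling A B (- 5616) (- 3888)
  trichotomy {Q} Q≈ (f , f-degree , f∣Q) = from-cubic (degree-3⇒cubic {f} f-degree)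
    where
    from-cubic : (∃[ e ] ∃[ a ] ∃[ b ] ∃[ d ] f ≈ cubic e a b d) →
      (∃[ w ] c ≡ w * (w * w - r * w + r * r)) ⊎ UpToScaling A B 128 256
        ⊎ UpToScaling A B (- 5616) (- 3888)
    from-cubic (e , a , b , d , f≈) = Sum.map₂ sporadic (Relation.root-or-g≡χ a b d r c vanish)
      where
      vanish : Annihilated a b d r c
      vanish x y z = subst (λ c → s 9 + r * s 6 + r * r * s 3 + c * s 0 ≡ 0) c≡
        (trans (sym (pair-quotient {A} {B} {r} {Q} Q≈ s))
          (pair-multiple {e} {a} {b} {d} {f} {Q} f≈ f∣Q x y z))
        where s = recurrence a b d x y z
      sporadic : r ≡ a * a * a - 3 * a * b + 3 * d × r * r ≡ b * b * b - 3 * a * b * d + 3 * d * d × c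
        ≡ d * d * d →
        UpToScaling A B 128 256 ⊎ UpToScaling A B (- 5616) (- 3888)
      sporadic (r≡ , r²≡ , c≡d³) = by-cases (a ≟ 0)
        where
        on-curve = curve a b d (subst (λ x → x * x ≡ b * b * b - 3 * a * b * d + 3 * d * d) r≡ r²≡)
        by-cases : Dec (a ≡ 0) → UpToScaling A B 128 256 ⊎ UpToScaling A B (- 5616) (- 3888)
        by-cases (yes a≡0) = inj₂ (a≡0⇒scaled {a} {b} {d} r≡ c≡d³ a≡0 on-curve)
        by-cases (no  a≢0) = inj₁ (H≡0⇒scaled {a} {b} {d} r≡ c≡d³ a≢0
          (ℚ-cancel a≢0 (curve⇒aH≡0 a b d on-curve)) on-curve)

-- The numerical factorisations and the classification.

factorisation-128-256 : trinomial 12 3 128 256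
  ≈ (X ^ₚ 3 +ₚ C 4)
    *ₚ (X ^ₚ 3 +ₚ C 2 *ₚ X ^ₚ 2 +ₚ C 4 *ₚ X +ₚ C 4)
    *ₚ (X ^ₚ 6 -ₚ C 2 *ₚ X ^ₚ 5 +ₚ C 8 *ₚ X ^ₚ 2 -ₚ C 16 *ₚ X +ₚ C 16)
factorisation-128-256 = λ
  { 0 → refl ; 1 → refl ; 2 → refl ; 3 → refl ; 4 → refl ; 5 → refl ; 6 → refl ; 7 → refl ; 8 → refl
  ; 9 → refl ; 10 → refl ; 11 → refl ; 12 → refl
  ; (suc (suc (suc (suc (suc (suc (suc (suc (suc (suc (suc (suc (suc n))))))))))))) → refl }

factorisation-5616-3888 : trinomial 12 3 (- 5616) (- 3888)
  ≈ (X ^ₚ 3 -ₚ C 18)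
    *ₚ (X ^ₚ 3 +ₚ C 6 *ₚ X +ₚ C 6)
    *ₚ (X ^ₚ 6 -ₚ C 6 *ₚ X ^ₚ 4 +ₚ C 12 *ₚ X ^ₚ 3 +ₚ C 36 *ₚ X ^ₚ 2
        -ₚ C 36 *ₚ X +ₚ C 36)
factorisation-5616-3888 = λ
  { 0 → refl ; 1 → refl ; 2 → refl ; 3 → refl ; 4 → refl ; 5 → refl ; 6 → refl ; 7 → refl ; 8 → refl
  ; 9 → refl ; 10 → refl ; 11 → refl ; 12 → refl
  ; (suc (suc (suc (suc (suc (suc (suc (suc (suc (suc (suc (suc (suc n))))))))))))) → refl }

theorem6p4 : (A B : ℚ) → A * B ≢ 0 →
    (r : ℚ) → IsRoot (trinomial 4 1 A B) r →
    (Q : Poly) → Q *ₚ (X ^ₚ 3 -ₚ C r) ≈ trinomial 12 3 A B →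
    HasFactorOfDegree Q 3 →
    (Σ[ w ∈ ℚ ]
    r * w * (r - w) ≢ 0
    × A ≡ - (r - w) * (r ^ 2 + w ^ 2)
    × B ≡ - r * w * (r ^ 2 - r * w + w ^ 2)
    × trinomial 12 3 A B
    ≈ (X ^ₚ 3 -ₚ C r) *ₚ (X ^ₚ 3 +ₚ C w)
    *ₚ (X ^ₚ 6 +ₚ C (r - w) *ₚ X ^ₚ 3 +ₚ C (r ^ 2 - r * w + w ^ 2)))
    ⊎ (UpToScaling A B 128 256
    × trinomial 12 3 128 256
    ≈ (X ^ₚ 3 +ₚ C 4)
    *ₚ (X ^ₚ 3 +ₚ C 2 *ₚ X ^ₚ 2 +ₚ C 4 *ₚ X +ₚ C 4)
    *ₚ (X ^ₚ 6 -ₚ C 2 *ₚ X ^ₚ 5 +ₚ C 8 *ₚ X ^ₚ 2 -ₚ C 16 *ₚ X +ₚ C 16))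
    ⊎ (UpToScaling A B (- 5616) (- 3888)
    × trinomial 12 3 (- 5616) (- 3888)
    ≈ (X ^ₚ 3 -ₚ C 18)
    *ₚ (X ^ₚ 3 +ₚ C 6 *ₚ X +ₚ C 6)
    *ₚ (X ^ₚ 6 -ₚ C 6 *ₚ X ^ₚ 4 +ₚ C 12 *ₚ X ^ₚ 3 +ₚ C 36 *ₚ X ^ₚ 2
    -ₚ C 36 *ₚ X +ₚ C 36))
theorem6p4 A B AB≢0 r root Q Q≈ factor = Sum.map
    (λ (w , c≡w) → w , family {A} {B} {r} A≢0 B≢0 refl B≡ w c≡w)
    (Sum.map (_, factorisation-128-256) (_, factorisation-5616-3888))
    (trichotomy {A} {B} {r} A≢0 B≢0 refl B≡ {Q} Q≈ factor)
  where
  A≢0 : A ≢ 0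
  A≢0 A≡0 = AB≢0 (trans (cong (_* B) A≡0) (ℚ.*-zeroˡ B))
  B≢0 : B ≢ 0
  B≢0 B≡0 = AB≢0 (trans (cong (A *_) B≡0) (ℚ.*-zeroʳ A))
  B≡ : B ≡ - r * (r * r * r + A)
  B≡ = root⇒B {A} {B} {r} root
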